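{- For all integers $n\geq 0$ we have $$H_n\big((2k+3)B_{2k+2}\big)=\frac{1}{2^{n+1}}\prod_{\ell=1}^n\left(\frac{\ell^{3}(\ell+1)^{3}}{4(2\ell+1)^{2}}\right)^{n+1-\ell}.$$
   Context: The Bernoulli numbers $B_k$ are defined by $\frac{t}{e^t-1}=\sum_{k\ge 0}B_k\frac{t^k}{k!}$. For a sequence $(c_0,c_1,\ldots)$ (indexed from $k=0$), $H_n(c_k)=\det\big(c_{i+j}\big)_{0\le i,j\le n}$; here $c_k=(2k+3)B_{2k+2}$. Empty products equal $1$. -}

module Defs where

open import Data.Fin.Base using (Fin; zero; suc; toℕ; punchIn)
open import Data.Integer.Base using (+_)
open import Data.Nat.Base as ℕ using (ℕ; zero; suc; _∸_; _!)
open import Data.Nat.Properties using (_!≢0)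
open import Data.Rational.Base using (ℚ; 0ℚ; 1ℚ; _+_; _*_; _-_; -_; _/_; toℚᵘ; fromℚᵘ; +-*-rawSemiring)
open import Data.Rational.Properties
import Data.Rational.Unnormalised.Base as ℚᵘ
import Data.Rational.Unnormalised.Properties as ℚᵘ
open import Data.Vec.Base using (Vec; []; _∷_; head; lookup)
open import Data.Vec.Functional using (Vector)
open import Relation.Binary.PropositionalEquality using (_≡_; refl; sym; trans; cong; cong₂; module ≡-Reasoning)

open import Algebra.Definitions.RawSemiring +-*-rawSemiring public using (sum; product; _^_)
open import Algebra.Properties.Monoid.Sum +-0-monoid using (sum-cong-≗)

fromℕ : ℕ → ℚ
fromℕ n = + n / 1

1/_! : ℕ → ℚ
1/ n ! = _/_ (+ 1) (n !) {{n !≢0}}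

-- Formal power series over ℚ; f n is the coefficient of tⁿ.
Series : Set
Series = ℕ → ℚ

one : Series
one zero    = 1ℚ
one (suc _) = 0ℚ

X : Series
X zero    = 0ℚ
X (suc n) = one n

infixl 7 _⊛_
_⊛_ : Series → Series → Series
(f ⊛ g) n = sum {suc n} λ i → f (toℕ i) * g (n ∸ toℕ i)

egf : (ℕ → ℚ) → Series
egf a n = a n * 1/ n !

[exp-1]/t : Series
[exp-1]/t n = 1/ (suc n) !

exp-1 : Series
exp-1 zero    = 0ℚ
exp-1 (suc n) = [exp-1]/t n

-- The first n coefficients, highest degree first, of the reciprocal of a series
-- with constant term 1:  rₙ = [n = 0] - (f₁ rₙ₋₁ + … + fₙ r₀).
reciprocalCoeffs : Series → (n : ℕ) → Vec ℚ n
reciprocalCoeffs f zero    = []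
reciprocalCoeffs f (suc n) =
  (one n - sum λ j → f (suc (toℕ j)) * lookup (reciprocalCoeffs f n) j)
  ∷ reciprocalCoeffs f n

reciprocal : Series → Series
reciprocal f n = head (reciprocalCoeffs f (suc n))

lookup-reciprocalCoeffs : ∀ f n (j : Fin n) →
  lookup (reciprocalCoeffs f n) j ≡ reciprocal f (n ∸ suc (toℕ j))
lookup-reciprocalCoeffs f (suc n) zero    = refl
lookup-reciprocalCoeffs f (suc n) (suc j) = lookup-reciprocalCoeffs f n j

⊛-reciprocal : ∀ f → f 0 ≡ 1ℚ → ∀ n → (f ⊛ reciprocal f) n ≡ one n
⊛-reciprocal f f₀≡1 n = begin
  f 0 * (one n - s) + t  ≡⟨ cong₂ (λ a b → a * (one n - s) + b) f₀≡1 (sym s≡t) ⟩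
  1ℚ * (one n - s) + s   ≡⟨ cong (_+ s) (*-identityˡ (one n - s)) ⟩
  (one n - s) + s        ≡⟨ +-assoc (one n) (- s) s ⟩
  one n + (- s + s)      ≡⟨ cong (λ z → one n + z) (+-inverseˡ s) ⟩
  one n + 0ℚ             ≡⟨ +-identityʳ (one n) ⟩
  one n                  ∎
  where
  open ≡-Reasoning
  s = sum {n} λ j → f (suc (toℕ j)) * lookup (reciprocalCoeffs f n) j
  t = sum {n} λ j → f (suc (toℕ j)) * reciprocal f (n ∸ suc (toℕ j))
  s≡t : s ≡ t
  s≡t = sum-cong-≗ {n} λ j → cong (λ z → f (suc (toℕ j)) * z) (lookup-reciprocalCoeffs f n j)

-- n! times the coefficient of tⁿ in t/(eᵗ - 1); so B₁ = -1/2.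
-- The generating function identity is bernoulli-egf.
bernoulli : ℕ → ℚ
bernoulli n = fromℕ (n !) * reciprocal [exp-1]/t n

fromℕ-*-1/ : ∀ m .{{_ : ℕ.NonZero m}} → fromℕ m * (+ 1 / m) ≡ 1ℚ
fromℕ-*-1/ (suc k) = toℚᵘ-injective (begin-equality
  toℚᵘ (fromℚᵘ p * fromℚᵘ q)             ≃⟨ toℚᵘ-homo-* (fromℚᵘ p) (fromℚᵘ q) ⟩
  toℚᵘ (fromℚᵘ p) ℚᵘ.* toℚᵘ (fromℚᵘ q)  ≃⟨ ℚᵘ.*-cong (toℚᵘ-fromℚᵘ p) (toℚᵘ-fromℚᵘ q) ⟩
  p ℚᵘ.* q                                ≃⟨ ℚᵘ.*-inverseʳ p ⟩
  ℚᵘ.1ℚᵘ                                  ∎)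
  where
  open ℚᵘ.≤-Reasoning
  p = ℚᵘ.mkℚᵘ (+ suc k) 0
  q = ℚᵘ.mkℚᵘ (+ 1) k

egf-bernoulli : ∀ n → egf bernoulli n ≡ reciprocal [exp-1]/t n
egf-bernoulli n = begin
  a * r * b    ≡⟨ cong (_* b) (*-comm a r) ⟩
  r * a * b    ≡⟨ *-assoc r a b ⟩
  r * (a * b)  ≡⟨ cong (λ z → r * z) (fromℕ-*-1/ (n !) {{n !≢0}}) ⟩
  r * 1ℚ       ≡⟨ *-identityʳ r ⟩
  r            ∎
  where
  open ≡-Reasoning
  a = fromℕ (n !)
  r = reciprocal [exp-1]/t n
  b = 1/ n !

bernoulli-egf : ∀ n → (exp-1 ⊛ egf bernoulli) n ≡ X n
bernoulli-egf zero    = refl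
bernoulli-egf (suc n) = begin
  0ℚ * egf bernoulli (suc n) + s  ≡⟨ cong (_+ s) (*-zeroˡ (egf bernoulli (suc n))) ⟩
  0ℚ + s                          ≡⟨ +-identityˡ s ⟩
  s                               ≡⟨ sum-cong-≗ {suc n} (λ i → cong (λ z → [exp-1]/t (toℕ i) * z) (egf-bernoulli (n ∸ toℕ i))) ⟩
  ([exp-1]/t ⊛ reciprocal [exp-1]/t) n
                                  ≡⟨ ⊛-reciprocal [exp-1]/t refl n ⟩
  one n                           ∎
  where
  open ≡-Reasoning
  s = ([exp-1]/t ⊛ egf bernoulli) n

-- Laplace expansion along the first row.
det : ∀ {n} → Vector (Vector ℚ n) n → ℚ
det {zero}  M = 1ℚ
det {suc n} M =
  sum λ j → (- 1ℚ) ^ toℕ j * M zero j * det (λ i k → M (suc i) (punchIn j k))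

-- The matrix has size n + 1, with indices 0 ≤ i, j ≤ n.
hankelDet : ℕ → (ℕ → ℚ) → ℚ
hankelDet n c = det {suc n} λ i j → c (toℕ i ℕ.+ toℕ j)

-- The product of f ℓ over 1 ≤ ℓ ≤ n.
∏[1⋯_] : ℕ → (ℕ → ℚ) → ℚ
∏[1⋯ n ] f = product {n} λ i → f (suc (toℕ i))

{-# OPTIONS --safe #-}
module Submission where

-- Let L be the functional xᵏ ↦ (2k + 3) B₂ₖ₊₂ and let Pₙ be the monic polynomials
-- with P₀ = 1 and Pₙ₊₁ = (x - αₙ) Pₙ - βₙ Pₙ₋₁ for the α and β below (they are
-- Wilson polynomials with parameters 0, 1, 1, 1). If L(xᵏ Pₙ) = 0 for k < n, then
-- column operations turn the last column of the Hankel matrix into (0, …, 0, L(xⁿ Pₙ)),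
-- so the determinants satisfy Hₙ = L(xⁿ Pₙ) Hₙ₋₁.
--
-- Orthogonality is tested against ψⱼ = (x - 1²)(x - 2²) ⋯ (x - j²) instead of xʲ.
-- Multiplication by x sends ψⱼ to ψⱼ₊₁ + (j + 1)² ψⱼ, so L(ψⱼ Pₙ) satisfies a
-- recurrence in n and j, whose solution has the factor j (j - 1) ⋯ (j - n + 1).
-- The initial values L(ψⱼ) come from E[G′(B + 1)] - E[G′(B)] = G″(0), where
-- E[xⁿ] = Bₙ umbrally: x³ ψⱼ(x²) is, up to a constant, G(x + 1) - G(x) for an explicit G
-- vanishing to second order at 0.

open import Defs
open import Data.Nat.Base as ℕ using (ℕ; zero; suc; _∸_; _!; s≤s)
import Data.Nat.Properties as ℕ
open import Data.Fin.Base as Fin using (Fin; zero; suc; toℕ; punchIn; pinch)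
import Data.Fin.Properties as Fin
open import Data.Integer.Base as ℤ using (+_)
import Data.Integer.Properties as ℤ
open import Data.List.Base as List using (List)
open import Data.Rational.Base using (ℚ; 0ℚ; 1ℚ; ½; _+_; _*_; _-_; -_; _/_; toℚᵘ)
open import Data.Rational.Properties
import Data.Rational.Unnormalised.Base as ℚᵘ
import Data.Rational.Unnormalised.Properties as ℚᵘ
open import Data.Sum.Base using (inj₁; inj₂)
open import Data.Vec.Functional using (Vector; []; _∷_; removeAt)
open import Function.Base using (_∘_)
open import Relation.Binary.PropositionalEquality using (_≡_; refl; sym; trans; cong; cong₂; subst; module ≡-Reasoning)
open import Relation.Nullary.Decidable using (dec⇒maybe)
open import Algebra.Bundles using (module CommutativeRing)
import Algebra.Properties.CommutativeMonoid.Sum *-1-commutativeMonoid as Product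
open import Algebra.Properties.Semiring.Sum (CommutativeRing.semiring +-*-commutativeRing) using (sum-cong-≗; sum-remove; *-distribˡ-sum)
open import Tactic.RingSolver using (solve-∀)
open import Tactic.RingSolver.Core.AlmostCommutativeRing using (AlmostCommutativeRing; fromCommutativeRing)

ring : AlmostCommutativeRing _ _
ring = fromCommutativeRing +-*-commutativeRing (λ x → dec⇒maybe (0ℚ ≟ x))

-- Determinants as functions of their columns.

sum-zero : ∀ {n} (f : Vector ℚ n) → (∀ k → f k ≡ 0ℚ) → sum f ≡ 0ℚ
sum-zero {zero}  f f≡0 = refl
sum-zero {suc n} f f≡0 = cong₂ _+_ (f≡0 zero) (sum-zero (f ∘ suc) (f≡0 ∘ suc))

det-cong : ∀ {n} {M N : Vector (Vector ℚ n) n} → (∀ i j → M i j ≡ N i j) → det M ≡ det N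
det-cong {zero}  M≡N = refl
det-cong {suc n} M≡N = sum-cong-≗ {suc n} λ j →
  cong₂ (λ x y → (- 1ℚ) ^ toℕ j * x * y) (M≡N zero j) (det-cong λ i k → M≡N (suc i) (punchIn j k))

shift : Series → Series
shift u k = u (suc k)

-- The shape of a three-term recurrence. Linearity is only ever used for this combination, both for
-- determinants and for functionals.
combine : ℚ → ℚ → Series → Series → Series → Series
combine a b x y z k = x k - a * y k - b * z k

-- The columns are infinite sequences, of which the first n entries count. Deleting the first row is
-- then `shift` on every column, so the Laplace expansion recurses without reindexing rows.
Det : ∀ {n} → Vector Series n → ℚ
Det C = det λ i j → C j (toℕ i)

Det-cong : ∀ {n} {C D : Vector Series n} → (∀ j k → C j k ≡ D j k) → Det C ≡ Det D
Det-cong C≡D = det-cong λ i j → C≡D j (toℕ i)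

minor : ∀ {n} → Vector Series (suc n) → Fin (suc n) → Vector Series n
minor C j = shift ∘ C ∘ punchIn j

cofactor : ∀ {n} → Vector Series (suc n) → Fin (suc n) → ℚ
cofactor C j = (- 1ℚ) ^ toℕ j * C j 0 * Det (minor C j)

cofactor₊ : ∀ {n} → Series → Vector Series (suc n) → Fin (suc n) → ℚ
cofactor₊ x C k = (- 1ℚ) ^ toℕ k * C k 0 * Det (shift x ∷ minor C k)

-- Every minor but the first keeps the rest of `x` as its front column, at the cost of one sign.
-- Stated this way, the expansion allows inductions on properties of the front column.
Det-∷ : ∀ {n} x (C : Vector Series (suc n)) →
  Det (x ∷ C) ≡ x 0 * Det (shift ∘ C) - sum (cofactor₊ x C)
Det-∷ {n} x C = begin
  1ℚ * x 0 * Det (shift ∘ C) + sum (cofactor (x ∷ C) ∘ suc)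
    ≡⟨ cong (λ s → 1ℚ * x 0 * Det (shift ∘ C) + s) (trans (sum-cong-≗ {suc n} term) (sym (*-distribˡ-sum (- 1ℚ) (cofactor₊ x C)))) ⟩
  1ℚ * x 0 * Det (shift ∘ C) + - 1ℚ * sum (cofactor₊ x C)
    ≡⟨ rearrange (x 0) (Det (shift ∘ C)) (sum (cofactor₊ x C)) ⟩
  x 0 * Det (shift ∘ C) - sum (cofactor₊ x C) ∎
  where
  open ≡-Reasoning
  rearrange : ∀ x d s → 1ℚ * x * d + - 1ℚ * s ≡ x * d - s
  rearrange = solve-∀ ring
  assoc³ : ∀ a b c d → a * b * c * d ≡ a * (b * c * d)
  assoc³ = solve-∀ ring
  columns : ∀ k j i → minor (x ∷ C) (suc k) j i ≡ (shift x ∷ minor C k) j i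
  columns k zero    i = refl
  columns k (suc j) i = refl
  term : ∀ k → cofactor (x ∷ C) (suc k) ≡ - 1ℚ * cofactor₊ x C k
  term k = trans (cong ((- 1ℚ) * (- 1ℚ) ^ toℕ k * C k 0 *_) (Det-cong (columns k))) (assoc³ (- 1ℚ) ((- 1ℚ) ^ toℕ k) (C k 0) (Det (shift x ∷ minor C k)))

sum-combine : ∀ {n} a b (w x y z : Vector ℚ n) →
  sum (λ k → w k * (x k - a * y k - b * z k)) ≡
  sum (λ k → w k * x k) - a * sum (λ k → w k * y k) - b * sum (λ k → w k * z k)
sum-combine {zero}  a b w x y z = base a b
  where
  base : ∀ a b → 0ℚ ≡ 0ℚ - a * 0ℚ - b * 0ℚ
  base = solve-∀ ring
sum-combine {suc n} a b w x y z =
  trans (cong (λ s → w zero * (x zero - a * y zero - b * z zero) + s) (sum-combine a b (w ∘ suc) (x ∘ suc) (y ∘ suc) (z ∘ suc)))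
        (rearrange a b (w zero) (x zero) (y zero) (z zero) _ _ _)
  where
  rearrange : ∀ a b w x y z X Y Z → w * (x - a * y - b * z) + (X - a * Y - b * Z) ≡
    w * x + X - a * (w * y + Y) - b * (w * z + Z)
  rearrange = solve-∀ ring

Det-combine : ∀ {n} a b x y z (C : Vector Series n) →
  Det (combine a b x y z ∷ C) ≡ Det (x ∷ C) - a * Det (y ∷ C) - b * Det (z ∷ C)
Det-combine {zero}  a b x y z C = base a b (x 0) (y 0) (z 0)
  where
  base : ∀ a b x y z → 1ℚ * (x - a * y - b * z) * 1ℚ + 0ℚ ≡
    1ℚ * x * 1ℚ + 0ℚ - a * (1ℚ * y * 1ℚ + 0ℚ) - b * (1ℚ * z * 1ℚ + 0ℚ)
  base = solve-∀ ring
Det-combine {suc n} a b x y z C = begin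
  Det (combine a b x y z ∷ C)
    ≡⟨ Det-∷ (combine a b x y z) C ⟩
  combine a b x y z 0 * d - sum (cofactor₊ (combine a b x y z) C)
    ≡⟨ cong (λ s → combine a b x y z 0 * d - s) sums ⟩
  combine a b x y z 0 * d - (σ x - a * σ y - b * σ z)
    ≡⟨ rearrange a b (x 0) (y 0) (z 0) d (σ x) (σ y) (σ z) ⟩
  (x 0 * d - σ x) - a * (y 0 * d - σ y) - b * (z 0 * d - σ z)
    ≡⟨ cong₂ _-_ (cong₂ (λ p q → p - a * q) (Det-∷ x C) (Det-∷ y C)) (cong (b *_) (Det-∷ z C)) ⟨
  Det (x ∷ C) - a * Det (y ∷ C) - b * Det (z ∷ C) ∎
  where
  open ≡-Reasoning
  d = Det (shift ∘ C)
  σ = λ u → sum (cofactor₊ u C)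
  weight : Vector ℚ (suc n)
  weight k = (- 1ℚ) ^ toℕ k * C k 0
  value : Series → Vector ℚ (suc n)
  value u k = Det (shift u ∷ minor C k)
  sums : σ (combine a b x y z) ≡ σ x - a * σ y - b * σ z
  sums = trans
    (sum-cong-≗ {suc n} λ k → cong (weight k *_) (Det-combine a b (shift x) (shift y) (shift z) (minor C k)))
    (sum-combine a b weight (value x) (value y) (value z))
  rearrange : ∀ a b x y z d X Y Z → (x - a * y - b * z) * d - (X - a * Y - b * Z) ≡
    (x * d - X) - a * (y * d - Y) - b * (z * d - Z)
  rearrange = solve-∀ ring

-- Expansion along a first column whose only nonzero entry is the last, obtained from first-row
-- expansions: by induction each minor contributes the same factor, and what remains is the
-- first-row expansion of `Det C`.
Det-firstZeros : ∀ {n} x (C : Vector Series n) → (∀ {k} → k ℕ.< n → x k ≡ 0ℚ) →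
  Det (x ∷ C) ≡ (- 1ℚ) ^ n * x n * Det C
Det-firstZeros {zero}  x C zeros = +-identityʳ _
Det-firstZeros {suc n} x C zeros = begin
  Det (x ∷ C)
    ≡⟨ Det-∷ x C ⟩
  x 0 * Det (shift ∘ C) - sum (cofactor₊ x C)
    ≡⟨ cong₂ (λ h s → h * Det (shift ∘ C) - s) (zeros ℕ.z<s) sums ⟩
  0ℚ * Det (shift ∘ C) - (- 1ℚ) ^ n * x (suc n) * Det C
    ≡⟨ rearrange (Det (shift ∘ C)) ((- 1ℚ) ^ n) (x (suc n)) (Det C) ⟩
  - 1ℚ * (- 1ℚ) ^ n * x (suc n) * Det C ∎
  where
  open ≡-Reasoning
  rearrange : ∀ d s x D → 0ℚ * d - s * x * D ≡ - 1ℚ * s * x * D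
  rearrange = solve-∀ ring
  pull : ∀ w s x d → w * (s * x * d) ≡ s * x * (w * d)
  pull = solve-∀ ring
  sums : sum (cofactor₊ x C) ≡ (- 1ℚ) ^ n * x (suc n) * Det C
  sums = trans
    (sum-cong-≗ {suc n} λ k → trans
      (cong ((- 1ℚ) ^ toℕ k * C k 0 *_) (Det-firstZeros (shift x) (minor C k) (zeros ∘ s≤s)))
      (pull ((- 1ℚ) ^ toℕ k * C k 0) ((- 1ℚ) ^ n) (x (suc n)) (Det (minor C k))))
    (sym (*-distribˡ-sum ((- 1ℚ) ^ n * x (suc n)) (cofactor C)))

-- In the first-row expansion the terms of the two copies of `x` cancel, and every other minor again
-- begins with two equal columns.
Det-doubled : ∀ {n} x (C : Vector Series n) → Det (x ∷ x ∷ C) ≡ 0ℚ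
Det-doubled {n} x C = begin
  Det (x ∷ x ∷ C)
    ≡⟨ Det-∷ x (x ∷ C) ⟩
  x 0 * Det (shift ∘ (x ∷ C)) - (1ℚ * x 0 * Det (shift x ∷ minor (x ∷ C) zero) + sum (cofactor₊ x (x ∷ C) ∘ suc))
    ≡⟨ cong₂ (λ d s → x 0 * Det (shift ∘ (x ∷ C)) - (1ℚ * x 0 * d + s)) (Det-cong first) (sum-zero _ (rest C)) ⟩
  x 0 * Det (shift ∘ (x ∷ C)) - (1ℚ * x 0 * Det (shift ∘ (x ∷ C)) + 0ℚ)
    ≡⟨ cancel (x 0) _ ⟩
  0ℚ ∎
  where
  open ≡-Reasoning
  cancel : ∀ x d → x * d - (1ℚ * x * d + 0ℚ) ≡ 0ℚ
  cancel = solve-∀ ring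
  first : ∀ j k → (shift x ∷ minor (x ∷ C) zero) j k ≡ shift ((x ∷ C) j) k
  first zero    k = refl
  first (suc j) k = refl
  columns : ∀ {m} (C : Vector Series (suc m)) i j k →
    (shift x ∷ minor (x ∷ C) (suc i)) j k ≡ (shift x ∷ shift x ∷ minor C i) j k
  columns C i zero          k = refl
  columns C i (suc zero)    k = refl
  columns C i (suc (suc j)) k = refl
  rest : ∀ {m} (C : Vector Series m) i → cofactor₊ x (x ∷ C) (suc i) ≡ 0ℚ
  rest {suc m} C i = trans
    (cong ((- 1ℚ) ^ suc (toℕ i) * C i 0 *_) (trans (Det-cong (columns C i)) (Det-doubled (shift x) (minor C i))))
    (*-zeroʳ ((- 1ℚ) ^ suc (toℕ i) * C i 0))

-- Once column `punchIn p k` is deleted, column p stands at position `pinch k p`. This and the next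
-- lemma compare the two orders of deleting the pair of columns.
punchIn-punchIn-pinch : ∀ {n} (p : Fin (suc (suc n))) k → punchIn (punchIn p k) (pinch k p) ≡ p
punchIn-punchIn-pinch zero    k       = refl
punchIn-punchIn-pinch (suc p) zero    = refl
punchIn-punchIn-pinch {suc n} (suc p) (suc k) = cong suc (punchIn-punchIn-pinch p k)

punchIn-punchIn : ∀ {n} (p : Fin (suc (suc n))) k j →
  punchIn (punchIn p k) (punchIn (pinch k p) j) ≡ punchIn p (punchIn k j)
punchIn-punchIn zero    k       j       = refl
punchIn-punchIn (suc p) zero    j       = refl
punchIn-punchIn (suc p) (suc k) zero    = refl
punchIn-punchIn (suc p) (suc k) (suc j) = cong suc (punchIn-punchIn p k j)

-- If p ≤ k, the first index is k + 1 and the second is p; otherwise they are k and p - 1. Either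
-- way the parity of the sum changes once.
sign-punchIn-pinch : ∀ {n} (p : Fin (suc (suc n))) k →
  (- 1ℚ) ^ toℕ (punchIn p k) * (- 1ℚ) ^ toℕ (pinch k p) ≡ - ((- 1ℚ) ^ toℕ p * (- 1ℚ) ^ toℕ k)
sign-punchIn-pinch zero    k = lemma ((- 1ℚ) ^ toℕ k)
  where
  lemma : ∀ a → - 1ℚ * a * 1ℚ ≡ - (1ℚ * a)
  lemma = solve-∀ ring
sign-punchIn-pinch (suc p) zero = lemma ((- 1ℚ) ^ toℕ p)
  where
  lemma : ∀ a → 1ℚ * a ≡ - (- 1ℚ * a * 1ℚ)
  lemma = solve-∀ ring
sign-punchIn-pinch {suc n} (suc p) (suc k) =
  trans (lemma₁ a b) (trans (sign-punchIn-pinch p k) (lemma₂ ((- 1ℚ) ^ toℕ p) ((- 1ℚ) ^ toℕ k)))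
  where
  a = (- 1ℚ) ^ toℕ (punchIn p k)
  b = (- 1ℚ) ^ toℕ (pinch k p)
  lemma₁ : ∀ a b → - 1ℚ * a * (- 1ℚ * b) ≡ a * b
  lemma₁ = solve-∀ ring
  lemma₂ : ∀ a b → - (a * b) ≡ - (- 1ℚ * a * (- 1ℚ * b))
  lemma₂ = solve-∀ ring

-- In the first-row expansion, the term of column p is the leading term of `Det-∷`. In every other
-- minor the induction hypothesis brings column p to the front, which yields the terms `cofactor₊`.
Det-toFront : ∀ {n} (C : Vector Series (suc n)) p →
  Det C ≡ (- 1ℚ) ^ toℕ p * Det (C p ∷ removeAt C p)
Det-toFront {zero} C zero = trans (Det-cong columns) (sym (*-identityˡ (Det (C zero ∷ removeAt C zero))))
  where
  columns : ∀ j k → C j k ≡ (C zero ∷ removeAt C zero) j k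
  columns zero k = refl
Det-toFront {suc n} C p = begin
  Det C
    ≡⟨ sum-remove {suc n} {p} (cofactor C) ⟩
  sign * C p 0 * Det (minor C p) + sum (λ k → cofactor C (punchIn p k))
    ≡⟨ cong (λ s → sign * C p 0 * Det (minor C p) + s)
         (trans (sum-cong-≗ {suc n} term) (sym (*-distribˡ-sum (- sign) (cofactor₊ (C p) (removeAt C p))))) ⟩
  sign * C p 0 * Det (minor C p) + - sign * sum (cofactor₊ (C p) (removeAt C p))
    ≡⟨ rearrange sign (C p 0) (Det (minor C p)) (sum (cofactor₊ (C p) (removeAt C p))) ⟩
  sign * (C p 0 * Det (minor C p) - sum (cofactor₊ (C p) (removeAt C p)))
    ≡⟨ cong (sign *_) (Det-∷ (C p) (removeAt C p)) ⟨
  sign * Det (C p ∷ removeAt C p) ∎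
  where
  open ≡-Reasoning
  sign = (- 1ℚ) ^ toℕ p
  rearrange : ∀ s x d S → s * x * d + - s * S ≡ s * (x * d - S)
  rearrange = solve-∀ ring
  regroup : ∀ a b c d → a * b * (c * d) ≡ a * c * (b * d)
  regroup = solve-∀ ring
  regroup′ : ∀ a b c d → - (a * b) * (c * d) ≡ - a * (b * c * d)
  regroup′ = solve-∀ ring
  columns : ∀ k j i → (minor C (punchIn p k) (pinch k p) ∷ removeAt (minor C (punchIn p k)) (pinch k p)) j i ≡
    (shift (C p) ∷ minor (removeAt C p) k) j i
  columns k zero    i = cong (λ q → C q (suc i)) (punchIn-punchIn-pinch p k)
  columns k (suc j) i = cong (λ q → C q (suc i)) (punchIn-punchIn p k j)
  term : ∀ k → cofactor C (punchIn p k) ≡ - sign * cofactor₊ (C p) (removeAt C p) k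
  term k = begin
    (- 1ℚ) ^ toℕ (punchIn p k) * x * Det (minor C (punchIn p k))
      ≡⟨ cong ((- 1ℚ) ^ toℕ (punchIn p k) * x *_)
           (trans (Det-toFront (minor C (punchIn p k)) (pinch k p)) (cong ((- 1ℚ) ^ toℕ (pinch k p) *_) (Det-cong (columns k)))) ⟩
    (- 1ℚ) ^ toℕ (punchIn p k) * x * ((- 1ℚ) ^ toℕ (pinch k p) * d)
      ≡⟨ regroup ((- 1ℚ) ^ toℕ (punchIn p k)) x ((- 1ℚ) ^ toℕ (pinch k p)) d ⟩
    (- 1ℚ) ^ toℕ (punchIn p k) * (- 1ℚ) ^ toℕ (pinch k p) * (x * d)
      ≡⟨ cong (_* (x * d)) (sign-punchIn-pinch p k) ⟩
    - (sign * (- 1ℚ) ^ toℕ k) * (x * d)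
      ≡⟨ regroup′ sign ((- 1ℚ) ^ toℕ k) x d ⟩
    - sign * ((- 1ℚ) ^ toℕ k * x * d) ∎
    where
    x = C (punchIn p k) 0
    d = Det (shift (C p) ∷ minor (removeAt C p) k)

Det-repeated : ∀ {n} (C : Vector Series n) p → Det (C p ∷ C) ≡ 0ℚ
Det-repeated {suc n} C p = begin
  Det (C p ∷ C)
    ≡⟨ Det-toFront (C p ∷ C) (suc p) ⟩
  sign * Det (C p ∷ removeAt (C p ∷ C) (suc p))
    ≡⟨ cong (sign *_) (Det-cong columns) ⟩
  sign * Det (C p ∷ C p ∷ removeAt C p)
    ≡⟨ cong (sign *_) (Det-doubled (C p) (removeAt C p)) ⟩
  sign * 0ℚ
    ≡⟨ *-zeroʳ sign ⟩
  0ℚ ∎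
  where
  open ≡-Reasoning
  sign = (- 1ℚ) ^ suc (toℕ p)
  columns : ∀ j k → (C p ∷ removeAt (C p ∷ C) (suc p)) j k ≡ (C p ∷ C p ∷ removeAt C p) j k
  columns zero          k = refl
  columns (suc zero)    k = refl
  columns (suc (suc j)) k = refl

-- Natural numbers and reciprocal factorials in ℚ.

fromℕ-+ : ∀ m n → fromℕ (m ℕ.+ n) ≡ fromℕ m + fromℕ n
fromℕ-+ m n = toℚᵘ-injective (begin-equality
  toℚᵘ (fromℕ (m ℕ.+ n))              ≃⟨ toℚᵘ-fromℚᵘ (ℚᵘ.mkℚᵘ (+ (m ℕ.+ n)) 0) ⟩
  ℚᵘ.mkℚᵘ (+ (m ℕ.+ n)) 0             ≃⟨ ℚᵘ.*≡* (cong (ℤ._* + 1) (sym (cong₂ ℤ._+_ (ℤ.*-identityʳ (+ m)) (ℤ.*-identityʳ (+ n))))) ⟩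
  p ℚᵘ.+ q                            ≃⟨ ℚᵘ.+-cong (toℚᵘ-fromℚᵘ p) (toℚᵘ-fromℚᵘ q) ⟨
  toℚᵘ (fromℕ m) ℚᵘ.+ toℚᵘ (fromℕ n)  ≃⟨ toℚᵘ-homo-+ (fromℕ m) (fromℕ n) ⟨
  toℚᵘ (fromℕ m + fromℕ n)            ∎)
  where
  open ℚᵘ.≤-Reasoning
  p = ℚᵘ.mkℚᵘ (+ m) 0
  q = ℚᵘ.mkℚᵘ (+ n) 0

fromℕ-* : ∀ m n → fromℕ (m ℕ.* n) ≡ fromℕ m * fromℕ n
fromℕ-* m n = toℚᵘ-injective (begin-equality
  toℚᵘ (fromℕ (m ℕ.* n))              ≃⟨ toℚᵘ-fromℚᵘ (ℚᵘ.mkℚᵘ (+ (m ℕ.* n)) 0) ⟩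
  ℚᵘ.mkℚᵘ (+ (m ℕ.* n)) 0             ≃⟨ ℚᵘ.*≡* (cong (ℤ._* + 1) (ℤ.pos-* m n)) ⟩
  p ℚᵘ.* q                            ≃⟨ ℚᵘ.*-cong (toℚᵘ-fromℚᵘ p) (toℚᵘ-fromℚᵘ q) ⟨
  toℚᵘ (fromℕ m) ℚᵘ.* toℚᵘ (fromℕ n)  ≃⟨ toℚᵘ-homo-* (fromℕ m) (fromℕ n) ⟨
  toℚᵘ (fromℕ m * fromℕ n)            ∎)
  where
  open ℚᵘ.≤-Reasoning
  p = ℚᵘ.mkℚᵘ (+ m) 0
  q = ℚᵘ.mkℚᵘ (+ n) 0

fromℕ-suc : ∀ n → fromℕ (suc n) ≡ fromℕ n + 1ℚ
fromℕ-suc n = trans (cong fromℕ (sym (ℕ.+-comm n 1))) (fromℕ-+ n 1)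

*-cancel-inverse : ∀ {a b} x y → b * a ≡ 1ℚ → a * x ≡ a * y → x ≡ y
*-cancel-inverse {a} {b} x y ba≡1 ax≡ay = begin
  x            ≡⟨ *-identityˡ x ⟨
  1ℚ * x       ≡⟨ cong (_* x) ba≡1 ⟨
  b * a * x    ≡⟨ *-assoc b a x ⟩
  b * (a * x)  ≡⟨ cong (b *_) ax≡ay ⟩
  b * (a * y)  ≡⟨ *-assoc b a y ⟨
  b * a * y    ≡⟨ cong (_* y) ba≡1 ⟩
  1ℚ * y       ≡⟨ *-identityˡ y ⟩
  y            ∎
  where open ≡-Reasoning

fromℕ-cancel : ∀ n .{{_ : ℕ.NonZero n}} x y → fromℕ n * x ≡ fromℕ n * y → x ≡ y
fromℕ-cancel n x y = *-cancel-inverse {b = + 1 / n} x y (trans (*-comm (+ 1 / n) (fromℕ n)) (fromℕ-*-1/ n))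

fromℕ-*-1/! : ∀ n → fromℕ (suc n) * 1/ suc n ! ≡ 1/ n !
fromℕ-*-1/! n = fromℕ-cancel (n !) {{n ℕ.!≢0}} _ _ (begin
  fromℕ (n !) * (fromℕ (suc n) * 1/ suc n !)  ≡⟨ swap (fromℕ (n !)) (fromℕ (suc n)) (1/ suc n !) ⟩
  fromℕ (suc n) * fromℕ (n !) * 1/ suc n !    ≡⟨ cong (_* 1/ suc n !) (fromℕ-* (suc n) (n !)) ⟨
  fromℕ (suc n !) * 1/ suc n !                ≡⟨ fromℕ-*-1/ (suc n !) {{suc n ℕ.!≢0}} ⟩
  1ℚ                                          ≡⟨ fromℕ-*-1/ (n !) {{n ℕ.!≢0}} ⟨
  fromℕ (n !) * 1/ n !                        ∎)
  where
  open ≡-Reasoning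
  swap : ∀ a b c → a * (b * c) ≡ b * a * c
  swap = solve-∀ ring

-- Formal power series, and functionals on ℚ[x] as moment sequences.

derivative : Series → Series
derivative f n = fromℕ (suc n) * f (suc n)

⊛-congˡ : ∀ {f f′} g → (∀ n → f n ≡ f′ n) → ∀ n → (f ⊛ g) n ≡ (f′ ⊛ g) n
⊛-congˡ g f≡f′ n = sum-cong-≗ {suc n} λ i → cong (_* g (n ∸ toℕ i)) (f≡f′ (toℕ i))

⊛-congʳ : ∀ f {g g′} → (∀ n → g n ≡ g′ n) → ∀ n → (f ⊛ g) n ≡ (f ⊛ g′) n
⊛-congʳ f g≡g′ n = sum-cong-≗ {suc n} λ i → cong (f (toℕ i) *_) (g≡g′ (n ∸ toℕ i))

⊛-distribʳ-+ : ∀ f g h n → ((λ k → f k + g k) ⊛ h) n ≡ (f ⊛ h) n + (g ⊛ h) n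
⊛-distribʳ-+ f g h zero    = lemma (f 0) (g 0) (h 0)
  where
  lemma : ∀ a b c → (a + b) * c + 0ℚ ≡ a * c + 0ℚ + (b * c + 0ℚ)
  lemma = solve-∀ ring
⊛-distribʳ-+ f g h (suc n) = trans
  (cong (λ s → (f 0 + g 0) * h (suc n) + s) (⊛-distribʳ-+ (shift f) (shift g) h n))
  (lemma (f 0) (g 0) (h (suc n)) _ _)
  where
  lemma : ∀ a b c s t → (a + b) * c + (s + t) ≡ a * c + s + (b * c + t)
  lemma = solve-∀ ring

-- Induction through f = f₀ + t h with h = `shift f`: differentiating t h gives h + t h′, which is
-- `shift-derivative`.
⊛-leibniz : ∀ f g n → derivative (f ⊛ g) n ≡ (derivative f ⊛ g) n + (f ⊛ derivative g) n
⊛-leibniz f g zero = lemma (fromℕ 1) (f 0) (f 1) (g 0) (g 1)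
  where
  lemma : ∀ i a b c d → i * (a * d + (b * c + 0ℚ)) ≡ i * b * c + 0ℚ + (a * (i * d) + 0ℚ)
  lemma = solve-∀ ring
⊛-leibniz f g (suc n) = begin
  i′ * (f 0 * g₂ + A)
    ≡⟨ cong (_* (f 0 * g₂ + A)) (fromℕ-suc (suc n)) ⟩
  (i + 1ℚ) * (f 0 * g₂ + A)
    ≡⟨ expand i (f 0) g₂ A ⟩
  (f 0 * ((i + 1ℚ) * g₂) + A) + i * A
    ≡⟨ cong₂ (λ x y → (f 0 * (x * g₂) + A) + y) (fromℕ-suc (suc n)) (sym (⊛-leibniz (shift f) g n)) ⟨
  (f 0 * (i′ * g₂) + (f 1 * g₁ + (shift (shift f) ⊛ g) n)) + ((derivative (shift f) ⊛ g) n + (shift f ⊛ derivative g) n)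
    ≡⟨ rearrange (f 0 * (i′ * g₂)) (f 1) g₁ ((shift (shift f) ⊛ g) n) ((derivative (shift f) ⊛ g) n) ((shift f ⊛ derivative g) n) ⟩
  (1ℚ * f 1 * g₁ + ((derivative (shift f) ⊛ g) n + (shift (shift f) ⊛ g) n)) + (f 0 * (i′ * g₂) + (shift f ⊛ derivative g) n)
    ≡⟨ cong (λ s → (1ℚ * f 1 * g₁ + s) + (f 0 * (i′ * g₂) + (shift f ⊛ derivative g) n))
         (trans (⊛-congˡ g shift-derivative n) (⊛-distribʳ-+ (derivative (shift f)) (shift (shift f)) g n)) ⟨
  (derivative f ⊛ g) (suc n) + (f ⊛ derivative g) (suc n) ∎
  where
  open ≡-Reasoning
  i  = fromℕ (suc n)
  i′ = fromℕ (suc (suc n))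
  g₁ = g (suc n)
  g₂ = g (suc (suc n))
  A  = (shift f ⊛ g) (suc n)
  expand : ∀ i f g A → (i + 1ℚ) * (f * g + A) ≡ (f * ((i + 1ℚ) * g) + A) + i * A
  expand = solve-∀ ring
  rearrange : ∀ p f g s t u → (p + (f * g + s)) + (t + u) ≡ (1ℚ * f * g + (t + s)) + (p + u)
  rearrange = solve-∀ ring
  shift-derivative : ∀ k → shift (derivative f) k ≡ derivative (shift f) k + shift (shift f) k
  shift-derivative k = trans (cong (_* f (suc (suc k))) (fromℕ-suc (suc k))) (lemma (fromℕ (suc k)) (f (suc (suc k))))
    where
    lemma : ∀ i x → (i + 1ℚ) * x ≡ i * x + x
    lemma = solve-∀ ring

⊛-shiftʳ : ∀ f g → g 0 ≡ 0ℚ → ∀ n → (f ⊛ g) (suc n) ≡ (f ⊛ shift g) n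
⊛-shiftʳ f g g₀≡0 zero = trans (cong (λ x → f 0 * g 1 + (f 1 * x + 0ℚ)) g₀≡0) (lemma (f 0 * g 1) (f 1))
  where
  lemma : ∀ a b → a + (b * 0ℚ + 0ℚ) ≡ a + 0ℚ
  lemma = solve-∀ ring
⊛-shiftʳ f g g₀≡0 (suc n) = cong (λ s → f 0 * g (suc (suc n)) + s) (⊛-shiftʳ (shift f) g g₀≡0 n)

-- A sequence u stands for the linear functional xᵏ ↦ u k on ℚ[x]. Then mul a u
-- is p ↦ u ((x - a) p), and translate u is p(x) ↦ u (p(x + 1)).
mul : ℚ → Series → Series
mul a u k = u (suc k) - a * u k

mulAll : List ℚ → Series → Series
mulAll List.[]       u = u
mulAll (a List.∷ as) u = mul a (mulAll as u)

exp : Series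
exp n = 1/ n !

-- The exponential generating function of the values at (x + 1)ⁿ is eᵗ times that of the values at
-- xⁿ. This form meets the defining equation of the Bernoulli numbers directly.
translate : Series → Series
translate u n = fromℕ (n !) * (exp ⊛ egf u) n

mul-cong : ∀ a {u v} → (∀ k → u k ≡ v k) → ∀ k → mul a u k ≡ mul a v k
mul-cong a u≡v k = cong₂ (λ x y → x - a * y) (u≡v (suc k)) (u≡v k)

mulAll-cong : ∀ as {u v} → (∀ k → u k ≡ v k) → ∀ k → mulAll as u k ≡ mulAll as v k
mulAll-cong List.[]       u≡v = u≡v
mulAll-cong (a List.∷ as) u≡v = mul-cong a (mulAll-cong as u≡v)

mulAll-combine : ∀ as a b x y z k →
  mulAll as (combine a b x y z) k ≡ combine a b (mulAll as x) (mulAll as y) (mulAll as z) k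
mulAll-combine List.[]       a b x y z k = refl
mulAll-combine (c List.∷ as) a b x y z k = trans
  (mul-cong c (mulAll-combine as a b x y z) k)
  (lemma a b c (mulAll as x (suc k)) (mulAll as y (suc k)) (mulAll as z (suc k)) (mulAll as x k) (mulAll as y k) (mulAll as z k))
  where
  lemma : ∀ a b c x y z x′ y′ z′ → (x - a * y - b * z) - c * (x′ - a * y′ - b * z′) ≡
    (x - c * x′) - a * (y - c * y′) - b * (z - c * z′)
  lemma = solve-∀ ring

mulAll-shift : ∀ as u k → mulAll as (shift u) k ≡ mulAll as u (suc k)
mulAll-shift List.[]       u k = refl
mulAll-shift (a List.∷ as) u k = mul-cong a (mulAll-shift as u) k

mulAll-mul : ∀ as b u k → mulAll as (mul b u) k ≡ mul b (mulAll as u) k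
mulAll-mul List.[]       b u k = refl
mulAll-mul (a List.∷ as) b u k = trans
  (mul-cong a (mulAll-mul as b u) k)
  (lemma a b (mulAll as u k) (mulAll as u (suc k)) (mulAll as u (suc (suc k))))
  where
  lemma : ∀ a b x y z → (z - b * y) - a * (y - b * x) ≡ (z - a * y) - b * (y - a * x)
  lemma = solve-∀ ring

translate-cong : ∀ {u v} → (∀ k → u k ≡ v k) → ∀ n → translate u n ≡ translate v n
translate-cong u≡v n = cong (fromℕ (n !) *_) (⊛-congʳ exp (λ k → cong (_* 1/ k !) (u≡v k)) n)

translate-zero : ∀ u → translate u 0 ≡ u 0
translate-zero u = lemma (u 0)
  where
  lemma : ∀ x → 1ℚ * (1ℚ * (x * 1ℚ) + 0ℚ) ≡ x
  lemma = solve-∀ ring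

-- This splits (x + 1)ⁿ⁺¹ as (x + 1)ⁿ + (x + 1)ⁿ x. It is the Leibniz rule for eᵗ `egf u`, since eᵗ
-- is its own derivative and differentiating an exponential generating function shifts its sequence.
translate-suc : ∀ u n → translate u (suc n) ≡ translate u n + translate (shift u) n
translate-suc u n = begin
  fromℕ (suc n !) * e (suc n)
    ≡⟨ cong (_* e (suc n)) (fromℕ-* (suc n) (n !)) ⟩
  fromℕ (suc n) * fromℕ (n !) * e (suc n)
    ≡⟨ swap (fromℕ (suc n)) (fromℕ (n !)) (e (suc n)) ⟩
  fromℕ (n !) * derivative e n
    ≡⟨ cong (fromℕ (n !) *_) (⊛-leibniz exp (egf u) n) ⟩
  fromℕ (n !) * ((derivative exp ⊛ egf u) n + (exp ⊛ derivative (egf u)) n)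
    ≡⟨ cong₂ (λ x y → fromℕ (n !) * (x + y)) (⊛-congˡ (egf u) fromℕ-*-1/! n) (⊛-congʳ exp derivative-egf n) ⟩
  fromℕ (n !) * (e n + (exp ⊛ egf (shift u)) n)
    ≡⟨ *-distribˡ-+ (fromℕ (n !)) (e n) _ ⟩
  translate u n + translate (shift u) n ∎
  where
  open ≡-Reasoning
  e = exp ⊛ egf u
  swap : ∀ a b c → a * b * c ≡ b * (a * c)
  swap = solve-∀ ring
  swap′ : ∀ a b c → a * (b * c) ≡ b * (a * c)
  swap′ = solve-∀ ring
  derivative-egf : ∀ k → derivative (egf u) k ≡ egf (shift u) k
  derivative-egf k = trans (swap′ (fromℕ (suc k)) (u (suc k)) (1/ suc k !)) (cong (u (suc k) *_) (fromℕ-*-1/! k))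

⊛-egf-mul : ∀ f a u n → (f ⊛ egf (mul a u)) n ≡ (f ⊛ egf (shift u)) n - a * (f ⊛ egf u) n
⊛-egf-mul f a u zero = lemma (f 0) a (u 1) (u 0) (1/ 0 !)
  where
  lemma : ∀ f a x y e → f * ((x - a * y) * e) + 0ℚ ≡ (f * (x * e) + 0ℚ) - a * (f * (y * e) + 0ℚ)
  lemma = solve-∀ ring
⊛-egf-mul f a u (suc n) = trans
  (cong (λ s → f 0 * egf (mul a u) (suc n) + s) (⊛-egf-mul (shift f) a u n))
  (lemma (f 0) a (u (suc (suc n))) (u (suc n)) (1/ suc n !) _ _)
  where
  lemma : ∀ f a x y e s t → f * ((x - a * y) * e) + (s - a * t) ≡ (f * (x * e) + s) - a * (f * (y * e) + t)
  lemma = solve-∀ ring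

-- Under x ↦ x + 1 the factor x - a becomes x - (a - 1).
mul-translate : ∀ a u n → mul a (translate u) n ≡ translate (mul (a - 1ℚ) u) n
mul-translate a u n = begin
  translate u (suc n) - a * translate u n
    ≡⟨ cong (_- a * translate u n) (translate-suc u n) ⟩
  translate u n + translate (shift u) n - a * translate u n
    ≡⟨ lemma (fromℕ (n !)) a ((exp ⊛ egf u) n) ((exp ⊛ egf (shift u)) n) ⟩
  fromℕ (n !) * ((exp ⊛ egf (shift u)) n - (a - 1ℚ) * (exp ⊛ egf u) n)
    ≡⟨ cong (fromℕ (n !) *_) (⊛-egf-mul exp (a - 1ℚ) u n) ⟨
  translate (mul (a - 1ℚ) u) n ∎
  where
  open ≡-Reasoning
  lemma : ∀ i a x y → i * x + i * y - a * (i * x) ≡ i * (y - (a - 1ℚ) * x)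
  lemma = solve-∀ ring

-- The Bernoulli functional on x (x² - 1²) ⋯ (x² - j²).

symmetricRoots : ℕ → List ℚ
symmetricRoots zero    = 0ℚ List.∷ List.[]
symmetricRoots (suc j) = fromℕ (suc j) List.∷ - fromℕ (suc j) List.∷ symmetricRoots j

-- With q = x (x² - 1) ⋯ (x² - j²), the polynomial (x - j - 1) q(x) becomes
-- (x + j + 1) q(x) when x is replaced by x + 1.
mulAll-translate : ∀ j u n →
  mulAll (symmetricRoots j) (mul (fromℕ (suc j)) (translate u)) n ≡
  translate (mulAll (symmetricRoots j) (mul (- fromℕ (suc j)) u)) n
mulAll-translate zero u n = begin
  mul 0ℚ (mul 1ℚ (translate u)) n            ≡⟨ mul-cong 0ℚ (mul-translate 1ℚ u) n ⟩
  mul 0ℚ (translate (mul 0ℚ u)) n            ≡⟨ mul-translate 0ℚ (mul 0ℚ u) n ⟩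
  translate (mul (- 1ℚ) (mul 0ℚ u)) n        ≡⟨ translate-cong (mulAll-mul (0ℚ List.∷ List.[]) (- 1ℚ) u) n ⟨
  translate (mul 0ℚ (mul (- 1ℚ) u)) n        ∎
  where open ≡-Reasoning
mulAll-translate (suc j) u n = begin
  mul a (mul (- a) (L (mul b (translate u)))) n
    ≡⟨ mul-cong a (mul-cong (- a) (mulAll-mul roots b (translate u))) n ⟩
  mul a (mul (- a) (mul b (L (translate u)))) n
    -- Trading places with `b` puts `a` next to `L`, where the induction hypothesis applies.
    ≡⟨ permute a b (t 0) (t 1) (t 2) (t 3) ⟩
  mul b (mul (- a) (mul a (L (translate u)))) n
    ≡⟨ mul-cong b (mul-cong (- a) λ k → trans (sym (mulAll-mul roots a (translate u) k)) (mulAll-translate j u k)) n ⟩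
  mul b (mul (- a) (translate w)) n
    ≡⟨ mul-cong b (mul-translate (- a) w) n ⟩
  mul b (translate (mul (- a - 1ℚ) w)) n
    ≡⟨ mul-translate b (mul (- a - 1ℚ) w) n ⟩
  translate (mul (b - 1ℚ) (mul (- a - 1ℚ) w)) n
    -- As b = a + 1, the moved roots b - 1 and - a - 1 are a and - b; together with the - a inside
    -- `w` they are the roots on the right-hand side.
    ≡⟨ translate-cong regroup n ⟩
  translate (mul a (mul (- a) (L (mul (- b) u)))) n ∎
  where
  open ≡-Reasoning
  a = fromℕ (suc j)
  b = fromℕ (suc (suc j))
  roots = symmetricRoots j
  L = mulAll roots
  w = L (mul (- a) u)
  t = λ i → L (translate u) (i ℕ.+ n)
  permute : ∀ a b x y z t →
    (t - b * z - - a * (z - b * y)) - a * ((z - b * y) - - a * (y - b * x)) ≡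
    (t - a * z - - a * (z - a * y)) - b * ((z - a * y) - - a * (y - a * x))
  permute = solve-∀ ring
  expand : ∀ a x y z t →
    (t - - a * z - (- a - 1ℚ) * (z - - a * y)) - (a + 1ℚ - 1ℚ) * ((z - - a * y) - (- a - 1ℚ) * (y - - a * x)) ≡
    (t - - (a + 1ℚ) * z - - a * (z - - (a + 1ℚ) * y)) - a * ((z - - (a + 1ℚ) * y) - - a * (y - - (a + 1ℚ) * x))
  expand = solve-∀ ring
  regroup : ∀ k → mul (b - 1ℚ) (mul (- a - 1ℚ) w) k ≡ mul a (mul (- a) (L (mul (- b) u))) k
  regroup k = begin
    mul (b - 1ℚ) (mul (- a - 1ℚ) w) k
      ≡⟨ mul-cong (b - 1ℚ) (mul-cong (- a - 1ℚ) (mulAll-mul roots (- a) u)) k ⟩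
    mul (b - 1ℚ) (mul (- a - 1ℚ) (mul (- a) (L u))) k
      ≡⟨ cong (λ b → mul (b - 1ℚ) (mul (- a - 1ℚ) (mul (- a) (L u))) k) (fromℕ-suc (suc j)) ⟩
    mul (a + 1ℚ - 1ℚ) (mul (- a - 1ℚ) (mul (- a) (L u))) k
      ≡⟨ expand a (L u k) (L u (suc k)) (L u (suc (suc k))) (L u (suc (suc (suc k)))) ⟩
    mul a (mul (- a) (mul (- (a + 1ℚ)) (L u))) k
      ≡⟨ cong (λ b → mul a (mul (- a) (mul (- b) (L u))) k) (fromℕ-suc (suc j)) ⟨
    mul a (mul (- a) (mul (- b) (L u))) k
      ≡⟨ mul-cong a (mul-cong (- a) (mulAll-mul roots (- b) u)) k ⟨
    mul a (mul (- a) (L (mul (- b) u))) k ∎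

-- p ↦ p′(B) in umbral notation
bernoulli′ : Series
bernoulli′ zero    = 0ℚ
bernoulli′ (suc n) = fromℕ (suc n) * bernoulli n

secondDerivativeAt0 : Series
secondDerivativeAt0 zero          = 0ℚ
secondDerivativeAt0 (suc zero)    = 0ℚ
secondDerivativeAt0 (suc (suc n)) = fromℕ (suc (suc n) !) * one n

egf-bernoulli′ : ∀ n → egf bernoulli′ (suc n) ≡ reciprocal [exp-1]/t n
egf-bernoulli′ n = begin
  fromℕ (suc n) * bernoulli n * 1/ suc n !    ≡⟨ swap (fromℕ (suc n)) (bernoulli n) (1/ suc n !) ⟩
  bernoulli n * (fromℕ (suc n) * 1/ suc n !)  ≡⟨ cong (bernoulli n *_) (fromℕ-*-1/! n) ⟩
  bernoulli n * 1/ n !                        ≡⟨ egf-bernoulli n ⟩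
  reciprocal [exp-1]/t n                      ∎
  where
  open ≡-Reasoning
  swap : ∀ a b c → a * b * c ≡ b * (a * c)
  swap = solve-∀ ring

-- The generating function of `bernoulli′` is t²/(eᵗ - 1). Multiplying it by eᵗ adds t², the
-- generating function of p ↦ p″(0).
translate-bernoulli′ : ∀ n → translate bernoulli′ n ≡ bernoulli′ n + secondDerivativeAt0 n
translate-bernoulli′ zero          = refl
translate-bernoulli′ (suc zero)    = refl
translate-bernoulli′ (suc (suc n)) = begin
  i * (1ℚ * (b * e) + ([exp-1]/t ⊛ egf bernoulli′) (suc n))
    ≡⟨ cong (λ s → i * (1ℚ * (b * e) + s)) (begin
         ([exp-1]/t ⊛ egf bernoulli′) (suc n)          ≡⟨ ⊛-shiftʳ [exp-1]/t (egf bernoulli′) refl n ⟩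
         ([exp-1]/t ⊛ shift (egf bernoulli′)) n        ≡⟨ ⊛-congʳ [exp-1]/t egf-bernoulli′ n ⟩
         ([exp-1]/t ⊛ reciprocal [exp-1]/t) n          ≡⟨ ⊛-reciprocal [exp-1]/t refl n ⟩
         one n                                         ∎) ⟩
  i * (1ℚ * (b * e) + one n)
    ≡⟨ expand i b e (one n) ⟩
  b * (i * e) + i * one n
    ≡⟨ cong (λ x → b * x + i * one n) (fromℕ-*-1/ (suc (suc n) !) {{suc (suc n) ℕ.!≢0}}) ⟩
  b * 1ℚ + i * one n
    ≡⟨ cong (_+ i * one n) (*-identityʳ b) ⟩
  b + i * one n ∎
  where
  open ≡-Reasoning
  i = fromℕ (suc (suc n) !)
  b = bernoulli′ (suc (suc n))
  e = 1/ suc (suc n) !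
  expand : ∀ i b e o → i * (1ℚ * (b * e) + o) ≡ b * (i * e) + i * o
  expand = solve-∀ ring

-- The number (-1)ʲ (j!)², the coefficient of x in x (x² - 1²) ⋯ (x² - j²).
signedSquareFactorial : ℕ → ℚ
signedSquareFactorial zero    = 1ℚ
signedSquareFactorial (suc j) = - (fromℕ (suc j) * fromℕ (suc j)) * signedSquareFactorial j

-- Only the linear term of the odd polynomial q matters for (q p)″(0). In the induction q gains the
-- factor x² - a², whose x² meets a power of x beyond the second and gives 0.
mulAll-secondDerivativeAt0 : ∀ j k →
  mulAll (symmetricRoots j) secondDerivativeAt0 k ≡ signedSquareFactorial j * secondDerivativeAt0 (suc k)
mulAll-secondDerivativeAt0 zero    k = lemma (secondDerivativeAt0 (suc k)) (secondDerivativeAt0 k)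
  where
  lemma : ∀ x y → x - 0ℚ * y ≡ 1ℚ * x
  lemma = solve-∀ ring
mulAll-secondDerivativeAt0 (suc j) k = begin
  mul a (mul (- a) (mulAll (symmetricRoots j) secondDerivativeAt0)) k
    ≡⟨ mul-cong a (mul-cong (- a) (mulAll-secondDerivativeAt0 j)) k ⟩
  (V * secondDerivativeAt0 (suc (suc (suc k))) - - a * (V * secondDerivativeAt0 (suc (suc k)))) - a * (V * secondDerivativeAt0 (suc (suc k)) - - a * (V * secondDerivativeAt0 (suc k)))
    ≡⟨ cong (λ x → (V * x - - a * (V * secondDerivativeAt0 (suc (suc k)))) - a * (V * secondDerivativeAt0 (suc (suc k)) - - a * (V * secondDerivativeAt0 (suc k)))) (*-zeroʳ (fromℕ (suc (suc (suc k)) !))) ⟩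
  (V * 0ℚ - - a * (V * secondDerivativeAt0 (suc (suc k)))) - a * (V * secondDerivativeAt0 (suc (suc k)) - - a * (V * secondDerivativeAt0 (suc k)))
    ≡⟨ lemma a V (secondDerivativeAt0 (suc (suc k))) (secondDerivativeAt0 (suc k)) ⟩
  - (a * a) * V * secondDerivativeAt0 (suc k) ∎
  where
  open ≡-Reasoning
  a = fromℕ (suc j)
  V = signedSquareFactorial j
  lemma : ∀ a V x y → (V * 0ℚ - - a * (V * x)) - a * (V * x - - a * (V * y)) ≡ - (a * a) * V * y
  lemma = solve-∀ ring

mulAll-+ : ∀ as u v k → mulAll as (λ i → u i + v i) k ≡ mulAll as u k + mulAll as v k
mulAll-+ List.[]       u v k = refl
mulAll-+ (a List.∷ as) u v k = trans (mul-cong a (mulAll-+ as u v) k)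
  (lemma a (mulAll as u k) (mulAll as u (suc k)) (mulAll as v k) (mulAll as v (suc k)))
  where
  lemma : ∀ a x y z t → (y + t) - a * (x + z) ≡ (y - a * x) + (t - a * z)
  lemma = solve-∀ ring

-- With q as above and G = x (x - 1) (x - j - 1) q, one has
-- G(x + 1) - G(x) = 2 (j + 2) x² q(x).
bernoulli′-symmetric : ∀ j →
  fromℕ (suc (suc j)) * mulAll (symmetricRoots j) bernoulli′ 2 ≡ fromℕ (suc j) * signedSquareFactorial j
bernoulli′-symmetric j = *-cancel-inverse {1ℚ + 1ℚ} {½} _ _ refl (begin
  (1ℚ + 1ℚ) * (fromℕ (suc (suc j)) * v 2)
    ≡⟨ cong (λ b → (1ℚ + 1ℚ) * (b * v 2)) (fromℕ-suc (suc j)) ⟩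
  (1ℚ + 1ℚ) * ((a + 1ℚ) * v 2)
    -- The first bracket is the value of `bernoulli′` at G(x + 1) = x (x + 1) (x + j + 1) q; the
    -- second is minus its value at G.
    ≡⟨ expand a (v 1) (v 2) (v 3) ⟩
  (mul (- a) v 1 + mul (- a) v 2) + (a * v 2 + v 2 - a * v 1 - v 3)
    ≡⟨ cong (_+ (a * v 2 + v 2 - a * v 1 - v 3)) (cong₂ _+_ (mulAll-mul roots (- a) bernoulli′ 1) (mulAll-mul roots (- a) bernoulli′ 2)) ⟨
  (w 1 + w 2) + (a * v 2 + v 2 - a * v 1 - v 3)
    ≡⟨ cong (_+ (a * v 2 + v 2 - a * v 1 - v 3)) difference ⟩
  (y 2 - y 1) + (a * v 2 + v 2 - a * v 1 - v 3)
    -- The values of `secondDerivativeAt0` at 2, 3 and 4 compute to 2, 0 and 0, so that G″(0) = 2 a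
    -- V.
    ≡⟨ cong (_+ (a * v 2 + v 2 - a * v 1 - v 3)) (cong₂ _-_ (y-mul 2) (y-mul 1)) ⟩
  (((v 3 + V * 0ℚ) - a * (v 2 + V * 0ℚ)) - ((v 2 + V * 0ℚ) - a * (v 1 + V * (1ℚ + 1ℚ)))) + (a * v 2 + v 2 - a * v 1 - v 3)
    ≡⟨ collect a V (v 1) (v 2) (v 3) ⟩
  (1ℚ + 1ℚ) * (a * V) ∎)
  where
  open ≡-Reasoning
  a = fromℕ (suc j)
  V = signedSquareFactorial j
  roots = symmetricRoots j
  v = mulAll roots bernoulli′
  w = mulAll roots (mul (- a) bernoulli′)
  y = mulAll roots (mul a (translate bernoulli′))
  expand : ∀ a x y z → (1ℚ + 1ℚ) * ((a + 1ℚ) * y) ≡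
    ((y - - a * x) + (z - - a * y)) + (a * y + y - a * x - z)
  expand = solve-∀ ring
  collect : ∀ a V x y z →
    (((z + V * 0ℚ) - a * (y + V * 0ℚ)) - ((y + V * 0ℚ) - a * (x + V * (1ℚ + 1ℚ)))) + (a * y + y - a * x - z) ≡ (1ℚ + 1ℚ) * (a * V)
  collect = solve-∀ ring
  y-mul : ∀ k → y k ≡ (v (suc k) + V * secondDerivativeAt0 (suc (suc k))) - a * (v k + V * secondDerivativeAt0 (suc k))
  y-mul k = trans (mulAll-mul roots a (translate bernoulli′) k) (mul-cong a (λ i → begin
    mulAll roots (translate bernoulli′) i
      ≡⟨ mulAll-cong roots translate-bernoulli′ i ⟩
    mulAll roots (λ n → bernoulli′ n + secondDerivativeAt0 n) i
      ≡⟨ mulAll-+ roots bernoulli′ secondDerivativeAt0 i ⟩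
    v i + mulAll roots secondDerivativeAt0 i
      ≡⟨ cong (λ x → v i + x) (mulAll-secondDerivativeAt0 j i) ⟩
    v i + V * secondDerivativeAt0 (suc i) ∎) k)
  y₁ : y 1 ≡ w 0 + w 1
  y₁ = begin
    y 1                                        ≡⟨ mulAll-translate j bernoulli′ 1 ⟩
    translate w 1                              ≡⟨ translate-suc w 0 ⟩
    translate w 0 + translate (shift w) 0      ≡⟨ cong₂ _+_ (translate-zero w) (translate-zero (shift w)) ⟩
    w 0 + w 1                                  ∎
  y₂ : y 2 ≡ (w 0 + w 1) + (w 1 + w 2)
  y₂ = begin
    y 2                                        ≡⟨ mulAll-translate j bernoulli′ 2 ⟩
    translate w 2                              ≡⟨ translate-suc w 1 ⟩
    translate w 1 + translate (shift w) 1      ≡⟨ cong₂ _+_ (translate-suc w 0) (translate-suc (shift w) 0) ⟩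
    (translate w 0 + translate (shift w) 0) + (translate (shift w) 0 + translate (shift (shift w)) 0)
      ≡⟨ cong₂ _+_ (cong₂ _+_ (translate-zero w) (translate-zero (shift w)))
                   (cong₂ _+_ (translate-zero (shift w)) (translate-zero (shift (shift w)))) ⟩
    (w 0 + w 1) + (w 1 + w 2) ∎
  cancel : ∀ x y → y ≡ x + y - x
  cancel = solve-∀ ring
  difference : w 1 + w 2 ≡ y 2 - y 1
  difference = trans (cancel (w 0 + w 1) (w 1 + w 2)) (sym (cong₂ _-_ y₂ y₁))

-- The variable x² and the test polynomials ψⱼ.

squares : ℕ → List ℚ
squares zero    = List.[]
squares (suc j) = fromℕ (suc j) * fromℕ (suc j) List.∷ squares j

moments : Series
moments k = bernoulli′ (3 ℕ.+ 2 ℕ.* k)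

-- The moments are those of x² under p ↦ (x³ p)′(B).
mulAll-moments : ∀ j k →
  mulAll (squares j) moments k ≡ mulAll (symmetricRoots j) bernoulli′ (2 ℕ.+ 2 ℕ.* k)
-- The root 0 supplies one of the three factors x, whence the index 2 + 2k against 3 + 2k in
-- `moments`.
mulAll-moments zero    k = lemma (bernoulli′ (3 ℕ.+ 2 ℕ.* k)) (bernoulli′ (2 ℕ.+ 2 ℕ.* k))
  where
  lemma : ∀ x y → x ≡ x - 0ℚ * y
  lemma = solve-∀ ring
mulAll-moments (suc j) k = begin
  mul (a * a) (mulAll (squares j) moments) k
    ≡⟨ mul-cong (a * a) (mulAll-moments j) k ⟩
  v (2 ℕ.+ 2 ℕ.* suc k) - a * a * v (2 ℕ.+ 2 ℕ.* k)
    ≡⟨ cong (λ i → v (2 ℕ.+ i) - a * a * v (2 ℕ.+ 2 ℕ.* k)) (ℕ.*-suc 2 k) ⟩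
  v (4 ℕ.+ 2 ℕ.* k) - a * a * v (2 ℕ.+ 2 ℕ.* k)
    ≡⟨ lemma a (v (2 ℕ.+ 2 ℕ.* k)) (v (3 ℕ.+ 2 ℕ.* k)) (v (4 ℕ.+ 2 ℕ.* k)) ⟩
  mul a (mul (- a) v) (2 ℕ.+ 2 ℕ.* k) ∎
  where
  open ≡-Reasoning
  a = fromℕ (suc j)
  v = mulAll (symmetricRoots j) bernoulli′
  lemma : ∀ a x y z → z - a * a * x ≡ (z - - a * y) - a * (y - - a * x)
  lemma = solve-∀ ring

-- By x ψⱼ = ψⱼ₊₁ + (j + 1)² ψⱼ, a value at xᵏ⁺¹ ψⱼ reduces to values at xᵏ ψⱼ₊₁ and xᵏ ψⱼ. The case
-- j = 0 returns from the ψⱼ to the powers of x.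
mulAll-squares-zero : ∀ {n} u → (∀ j → j ℕ.< n → mulAll (squares j) u 0 ≡ 0ℚ) →
  ∀ k j → k ℕ.+ j ℕ.< n → mulAll (squares j) u k ≡ 0ℚ
mulAll-squares-zero {n} u zeros zero    j j<n = zeros j j<n
mulAll-squares-zero {n} u zeros (suc k) j k+j<n = begin
  mulAll (squares j) u (suc k)
    ≡⟨ lemma (mulAll (squares j) u (suc k)) a (mulAll (squares j) u k) ⟩
  mulAll (squares (suc j)) u k + a * a * mulAll (squares j) u k
    ≡⟨ cong₂ (λ x y → x + a * a * y)
         (mulAll-squares-zero u zeros k (suc j) (subst (ℕ._< n) (sym (ℕ.+-suc k j)) k+j<n))
         (mulAll-squares-zero u zeros k j (ℕ.<⇒≤ k+j<n)) ⟩
  0ℚ + a * a * 0ℚ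
    ≡⟨ zeroes a ⟩
  0ℚ ∎
  where
  open ≡-Reasoning
  a = fromℕ (suc j)
  lemma : ∀ x a y → x ≡ (x - a * a * y) + a * a * y
  lemma = solve-∀ ring
  zeroes : ∀ a → 0ℚ + a * a * 0ℚ ≡ 0ℚ
  zeroes = solve-∀ ring

-- Both xᵏ ψⱼ and ψₙ are monic of degree n, and `u` kills their difference, which has lower degree.
mulAll-squares-last : ∀ {n} u → (∀ j → j ℕ.< n → mulAll (squares j) u 0 ≡ 0ℚ) →
  ∀ k j → k ℕ.+ j ≡ n → mulAll (squares j) u k ≡ mulAll (squares n) u 0
mulAll-squares-last u zeros zero    j refl = refl
mulAll-squares-last u zeros (suc k) j refl = begin
  mulAll (squares j) u (suc k)
    ≡⟨ lemma (mulAll (squares j) u (suc k)) a ⟩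
  mulAll (squares j) u (suc k) - a * a * 0ℚ
    ≡⟨ cong (λ x → mulAll (squares j) u (suc k) - a * a * x) (mulAll-squares-zero u zeros k j (ℕ.n<1+n _)) ⟨
  mulAll (squares (suc j)) u k
    ≡⟨ mulAll-squares-last u zeros k (suc j) (ℕ.+-suc k j) ⟩
  mulAll (squares (suc k ℕ.+ j)) u 0 ∎
  where
  open ≡-Reasoning
  a = fromℕ (suc j)
  lemma : ∀ x a → x ≡ x - a * a * 0ℚ
  lemma = solve-∀ ring

-- Three-term recurrences and column operations on Hankel matrices.

toℕ-punchIn-last : ∀ {n} (j : Fin n) → toℕ (punchIn (Fin.fromℕ n) j) ≡ toℕ j
toℕ-punchIn-last {suc n} zero    = refl
toℕ-punchIn-last {suc n} (suc j) = cong suc (toℕ-punchIn-last j)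

sign-square : ∀ m → (- 1ℚ) ^ m * (- 1ℚ) ^ m ≡ 1ℚ
sign-square zero    = refl
sign-square (suc m) = trans (lemma ((- 1ℚ) ^ m)) (sign-square m)
  where
  lemma : ∀ s → - 1ℚ * s * (- 1ℚ * s) ≡ s * s
  lemma = solve-∀ ring

-- The functionals p ↦ u (Pₙ p), for the monic polynomials with P₀ = 1 and
-- Pₙ₊₁ = (x - α n) Pₙ - β n Pₙ₋₁.
module Recurrence (u : Series) (α β : ℕ → ℚ) (β₀≡0 : β 0 ≡ 0ℚ) where

  P : ℕ → Series
  P zero          = u
  -- The last `u` stands in for P₋₁; its coefficient `β 0` is 0.
  P (suc zero)    = combine (α 0) (β 0) (shift u) u u
  P (suc (suc n)) = combine (α (suc n)) (β (suc n)) (shift (P (suc n))) (P (suc n)) (P n)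

  columns : ∀ m → Vector Series m
  columns m j i = u (i ℕ.+ toℕ j)

  module _ (m : ℕ) where

    -- Column operations become evaluations of this functional: it is linear in `r` and vanishes at
    -- every column of the matrix.
    D : Series → ℚ
    D r = Det (r ∷ columns m)

    D-cong : ∀ {r s} → (∀ k → r k ≡ s k) → D r ≡ D s
    D-cong {r} {s} r≡s = Det-cong eq
      where
      eq : ∀ j k → (r ∷ columns m) j k ≡ (s ∷ columns m) j k
      eq zero    k = r≡s k
      eq (suc j) k = refl

    D-step : ∀ a b x y z i → D (λ t → combine a b (shift x) y z (t ℕ.+ i)) ≡
      D (λ t → x (t ℕ.+ suc i)) - a * D (λ t → y (t ℕ.+ i)) - b * D (λ t → z (t ℕ.+ i))
    D-step a b x y z i = trans
      (Det-combine a b (λ t → x (suc (t ℕ.+ i))) (λ t → y (t ℕ.+ i)) (λ t → z (t ℕ.+ i)) (columns m))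
      (cong (λ d → d - a * D (λ t → y (t ℕ.+ i)) - b * D (λ t → z (t ℕ.+ i)))
        (D-cong λ t → cong x (sym (ℕ.+-suc t i))))

    drop-zeros : ∀ a b {x y z w} → x ≡ w → y ≡ 0ℚ → z ≡ 0ℚ → x - a * y - b * z ≡ w
    drop-zeros a b {x} refl refl refl = lemma a b x
      where
      lemma : ∀ a b x → x - a * 0ℚ - b * 0ℚ ≡ x
      lemma = solve-∀ ring

    -- `P n` shifted by i combines the shifts of `u` by i, ..., n + i, and all of these are columns
    -- already.
    D-zero : ∀ n i → n ℕ.+ i ℕ.< m → D (λ t → P n (t ℕ.+ i)) ≡ 0ℚ
    D-zero zero i i<m = trans
      (D-cong λ t → cong (λ j → u (t ℕ.+ j)) (sym (Fin.toℕ-fromℕ< i<m)))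
      (Det-repeated (columns m) (Fin.fromℕ< i<m))
    D-zero (suc zero) i lt = trans (D-step (α 0) (β 0) u u u i)
      (drop-zeros (α 0) (β 0) (D-zero 0 (suc i) lt) (D-zero 0 i (ℕ.<⇒≤ lt)) (D-zero 0 i (ℕ.<⇒≤ lt)))
    D-zero (suc (suc n)) i lt = trans (D-step (α (suc n)) (β (suc n)) (P (suc n)) (P (suc n)) (P n) i)
      (drop-zeros (α (suc n)) (β (suc n))
        (D-zero (suc n) (suc i) (subst (ℕ._< m) (cong suc (sym (ℕ.+-suc n i))) lt))
        (D-zero (suc n) i (ℕ.<⇒≤ lt))
        (D-zero n i (ℕ.<⇒≤ (ℕ.<⇒≤ lt))))

    -- Since Pₙ is monic, the shift by n + i = m occurs with coefficient 1; the smaller shifts are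
    -- columns.
    D-last : ∀ n i → n ℕ.+ i ≡ m → D (λ t → P n (t ℕ.+ i)) ≡ D (λ t → u (t ℕ.+ m))
    D-last zero i refl = refl
    D-last (suc zero) i refl = trans (D-step (α 0) (β 0) u u u i)
      (drop-zeros (α 0) (β 0) refl (D-zero 0 i ℕ.≤-refl) (D-zero 0 i ℕ.≤-refl))
    D-last (suc (suc n)) i refl = trans (D-step (α (suc n)) (β (suc n)) (P (suc n)) (P (suc n)) (P n) i)
      (drop-zeros (α (suc n)) (β (suc n))
        (D-last (suc n) (suc i) (cong suc (ℕ.+-suc n i)))
        (D-zero (suc n) i ℕ.≤-refl)
        (D-zero n i (ℕ.<⇒≤ ℕ.≤-refl)))

  -- The last column moves to the front, is replaced there by `P m`, and the determinant is expanded
  -- along it. The signs of the move and of the expansion cancel.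
  Det-step : ∀ m → (∀ {k} → k ℕ.< m → P m k ≡ 0ℚ) →
    Det (columns (suc m)) ≡ P m m * Det (columns m)
  Det-step m zeros = begin
    Det (columns (suc m))
      ≡⟨ Det-toFront (columns (suc m)) (Fin.fromℕ m) ⟩
    (- 1ℚ) ^ toℕ (Fin.fromℕ m) * Det (columns (suc m) (Fin.fromℕ m) ∷ removeAt (columns (suc m)) (Fin.fromℕ m))
      ≡⟨ cong₂ _*_ (cong ((- 1ℚ) ^_) (Fin.toℕ-fromℕ m)) (Det-cong eq) ⟩
    (- 1ℚ) ^ m * D m (λ t → u (t ℕ.+ m))
      ≡⟨ cong ((- 1ℚ) ^ m *_) (D-last m m 0 (ℕ.+-identityʳ m)) ⟨
    (- 1ℚ) ^ m * D m (λ t → P m (t ℕ.+ 0))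
      ≡⟨ cong ((- 1ℚ) ^ m *_) (D-cong m λ t → cong (P m) (ℕ.+-identityʳ t)) ⟩
    (- 1ℚ) ^ m * D m (P m)
      ≡⟨ cong ((- 1ℚ) ^ m *_) (Det-firstZeros (P m) (columns m) zeros) ⟩
    (- 1ℚ) ^ m * ((- 1ℚ) ^ m * P m m * Det (columns m))
      ≡⟨ regroup ((- 1ℚ) ^ m) (P m m) (Det (columns m)) ⟩
    (- 1ℚ) ^ m * (- 1ℚ) ^ m * (P m m * Det (columns m))
      ≡⟨ cong (_* (P m m * Det (columns m))) (sign-square m) ⟩
    1ℚ * (P m m * Det (columns m))
      ≡⟨ *-identityˡ _ ⟩
    P m m * Det (columns m) ∎
    where
    open ≡-Reasoning
    regroup : ∀ s p d → s * (s * p * d) ≡ s * s * (p * d)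
    regroup = solve-∀ ring
    eq : ∀ j k → (columns (suc m) (Fin.fromℕ m) ∷ removeAt (columns (suc m)) (Fin.fromℕ m)) j k ≡
      ((λ t → u (t ℕ.+ m)) ∷ columns m) j k
    eq zero    k = cong (λ i → u (k ℕ.+ i)) (Fin.toℕ-fromℕ m)
    eq (suc j) k = cong (λ i → u (k ℕ.+ i)) (toℕ-punchIn-last j)

-- The Wilson recurrence and the closed form of L(ψⱼ Pₙ).

1/1+_ : ℕ → ℚ
1/1+ n = + 1 / suc n

-- Reciprocals are atoms for the ring solver and are eliminated through explicit equations such as
-- `1/odd-inverse`.
1/odd : ℕ → ℚ
1/odd n = 1/1+ (n ℕ.+ n)

-- With Aₙ = (n + 1)² (n + 2) / (2 (2n + 3)) and Cₙ = n (n + 1)² / (2 (2n + 1)), the Wilson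
-- coefficients for parameters 0, 1, 1, 1, `α n` is - (Aₙ + Cₙ) and `β n` is Aₙ₋₁ Cₙ.
α : ℕ → ℚ
α n = (fromℕ n + 1ℚ) * (fromℕ n + 1ℚ) *
  (1ℚ - (fromℕ n + (1ℚ + 1ℚ)) * (fromℕ n + (1ℚ + 1ℚ)) * 1/odd (suc n) + fromℕ n * fromℕ n * 1/odd n)

β : ℕ → ℚ
β n = cube (fromℕ n) * cube (fromℕ n + 1ℚ) * (½ * ½) * (1/odd n * 1/odd n)
  where
  cube : ℚ → ℚ
  cube x = x * x * x

open Recurrence moments α β refl

-- The factor of L(ψⱼ Pₙ) that depends on n alone, equal to (-1)ⁿ (n + 1) A₀ ⋯ Aₙ₋₁ with Aₙ as
-- above.
κ : ℕ → ℚ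
κ zero    = 1ℚ
κ (suc n) = - ½ * (fromℕ n + 1ℚ) * ((fromℕ n + (1ℚ + 1ℚ)) * (fromℕ n + (1ℚ + 1ℚ))) * 1/odd (suc n) * κ n

-- j (j - 1) ⋯ (j - n + 1) / ((j + 1) ⋯ (j + n + 2))
F : ℕ → ℕ → ℚ
F zero    j = 1/1+ j * 1/1+ suc j
F (suc n) j = F n j * (fromℕ j - fromℕ n) * 1/1+ suc (suc n ℕ.+ j)

fromℕ-*-1/1+ : ∀ n → (fromℕ n + 1ℚ) * 1/1+ n ≡ 1ℚ
fromℕ-*-1/1+ n = trans (cong (_* 1/1+ n) (sym (fromℕ-suc n))) (fromℕ-*-1/ (suc n))

-- One factor j + 1 is new in the numerator; the other offsets the denominator, which now starts at
-- j + 2 and ends at j + n + 4.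
F-shift : ∀ n j → F (suc n) (suc j) ≡
  F n j * ((fromℕ j + 1ℚ) * (fromℕ j + 1ℚ)) * 1/1+ suc (suc n ℕ.+ j) * 1/1+ suc (suc (suc n ℕ.+ j))
F-shift zero j = begin
  1/1+ suc j * 1/1+ suc (suc j) * (fromℕ (suc j) - 0ℚ) * 1/1+ suc (suc (suc j))
    ≡⟨ cong (λ x → 1/1+ suc j * 1/1+ suc (suc j) * (x - 0ℚ) * 1/1+ suc (suc (suc j))) (fromℕ-suc j) ⟩
  1/1+ suc j * 1/1+ suc (suc j) * (J + 1ℚ - 0ℚ) * 1/1+ suc (suc (suc j))
    ≡⟨ expand (J + 1ℚ) (1/1+ suc j) (1/1+ suc (suc j)) (1/1+ suc (suc (suc j))) ⟩
  1ℚ * 1/1+ suc j * (J + 1ℚ) * 1/1+ suc (suc j) * 1/1+ suc (suc (suc j))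
    ≡⟨ cong (λ x → x * 1/1+ suc j * (J + 1ℚ) * 1/1+ suc (suc j) * 1/1+ suc (suc (suc j))) (fromℕ-*-1/1+ j) ⟨
  (J + 1ℚ) * 1/1+ j * 1/1+ suc j * (J + 1ℚ) * 1/1+ suc (suc j) * 1/1+ suc (suc (suc j))
    ≡⟨ regroup (J + 1ℚ) (1/1+ j) (1/1+ suc j) (1/1+ suc (suc j)) (1/1+ suc (suc (suc j))) ⟩
  1/1+ j * 1/1+ suc j * ((J + 1ℚ) * (J + 1ℚ)) * 1/1+ suc (suc j) * 1/1+ suc (suc (suc j)) ∎
  where
  open ≡-Reasoning
  J = fromℕ j
  expand : ∀ a x y z → x * y * (a - 0ℚ) * z ≡ 1ℚ * x * a * y * z
  expand = solve-∀ ring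
  regroup : ∀ a w x y z → a * w * x * a * y * z ≡ w * x * (a * a) * y * z
  regroup = solve-∀ ring
F-shift (suc n) j = begin
  F (suc n) (suc j) * (fromℕ (suc j) - fromℕ (suc n)) * 1/1+ suc (suc (suc n) ℕ.+ suc j)
    ≡⟨ cong₂ (λ x i → F (suc n) (suc j) * x * 1/1+ suc (suc (suc i))) difference (ℕ.+-suc n j) ⟩
  F (suc n) (suc j) * (fromℕ j - fromℕ n) * 1/1+ suc (suc (suc (suc (n ℕ.+ j))))
    ≡⟨ cong (λ x → x * (fromℕ j - fromℕ n) * 1/1+ suc (suc (suc (suc (n ℕ.+ j))))) (F-shift n j) ⟩
  F n j * (A * A) * 1/1+ suc (suc n ℕ.+ j) * 1/1+ suc (suc (suc n ℕ.+ j)) * (fromℕ j - fromℕ n) * 1/1+ suc (suc (suc (suc (n ℕ.+ j))))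
    ≡⟨ regroup (F n j) (A * A) (1/1+ suc (suc n ℕ.+ j)) (1/1+ suc (suc (suc n ℕ.+ j))) (fromℕ j - fromℕ n) (1/1+ suc (suc (suc (suc (n ℕ.+ j))))) ⟩
  F n j * (fromℕ j - fromℕ n) * 1/1+ suc (suc n ℕ.+ j) * (A * A) * 1/1+ suc (suc (suc n ℕ.+ j)) * 1/1+ suc (suc (suc (suc (n ℕ.+ j)))) ∎
  where
  open ≡-Reasoning
  A = fromℕ j + 1ℚ
  regroup : ∀ f a x y d z → f * a * x * y * d * z ≡ f * d * x * a * y * z
  regroup = solve-∀ ring
  difference : fromℕ (suc j) - fromℕ (suc n) ≡ fromℕ j - fromℕ n
  difference = trans (cong₂ _-_ (fromℕ-suc j) (fromℕ-suc n)) (lemma (fromℕ j) (fromℕ n))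
    where
    lemma : ∀ x y → (x + 1ℚ) - (y + 1ℚ) ≡ x - y
    lemma = solve-∀ ring

F-zero : ∀ n j → j ℕ.< n → F n j ≡ 0ℚ
F-zero (suc n) j (s≤s j≤n) with ℕ.m≤n⇒m<n∨m≡n j≤n
... | inj₁ j<n  = trans (cong (λ x → x * (fromℕ j - fromℕ n) * 1/1+ suc (suc n ℕ.+ j)) (F-zero n j j<n))
                        (lemma (fromℕ j - fromℕ n) (1/1+ suc (suc n ℕ.+ j)))
  where
  lemma : ∀ x y → 0ℚ * x * y ≡ 0ℚ
  lemma = solve-∀ ring
... | inj₂ refl = lemma (F n n) (fromℕ n) (1/1+ suc (suc n ℕ.+ n))
  where
  lemma : ∀ f x y → f * (x - x) * y ≡ 0ℚ
  lemma = solve-∀ ring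

-- Clearing the denominators p, q, u, v: the two sides differ by a combination
-- of p (2M + 1) - 1, q (2M + 3) - 1, u (J + M + 2) - 1 and v (J + M + 3) - 1.
recurrence-identity : ∀ J M p q u v w f g →
  p * (M + M + 1ℚ) ≡ 1ℚ → q * (M + M + (1ℚ + (1ℚ + 1ℚ))) ≡ 1ℚ →
  u * (J + M + (1ℚ + 1ℚ)) ≡ 1ℚ → v * (J + M + (1ℚ + (1ℚ + 1ℚ))) ≡ 1ℚ →
  g ≡ f * (J - M + 1ℚ) * u →
  w * (- ½ * (M + 1ℚ) * ((M + (1ℚ + 1ℚ)) * (M + (1ℚ + 1ℚ))) * q) * (g * (J - M) * v) ≡
  (- ((J + (1ℚ + 1ℚ)) * (J + (1ℚ + 1ℚ))) * w * (f * ((J + 1ℚ) * (J + 1ℚ)) * u * v) + (J + 1ℚ) * (J + 1ℚ) * (w * g))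
  - (M + 1ℚ) * (M + 1ℚ) * (1ℚ - (M + (1ℚ + 1ℚ)) * (M + (1ℚ + 1ℚ)) * q + M * M * p) * (w * g)
  + ½ * (M * M * (M + 1ℚ)) * p * (w * f)
recurrence-identity J M p q u v w f g p-inv q-inv u-inv v-inv refl = begin
  w * (- ½ * (M + 1ℚ) * ((M + (1ℚ + 1ℚ)) * (M + (1ℚ + 1ℚ))) * q) * ((f * (J - M + 1ℚ) * u) * (J - M) * v)
    ≡⟨ difference J M p q u v w f ⟩
  rhs + b * (p * (M + M + 1ℚ) - 1ℚ) + c * (q * (M + M + (1ℚ + (1ℚ + 1ℚ))) - 1ℚ) + t * (u * (J + M + (1ℚ + 1ℚ)) - 1ℚ) + (s + t * (u * (J + M + (1ℚ + 1ℚ)))) * (v * (J + M + (1ℚ + (1ℚ + 1ℚ))) - 1ℚ)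
    ≡⟨ cong₂ (λ x y → rhs + b * (x - 1ℚ) + c * (y - 1ℚ) + t * (u * (J + M + (1ℚ + 1ℚ)) - 1ℚ) + (s + t * (u * (J + M + (1ℚ + 1ℚ)))) * (v * (J + M + (1ℚ + (1ℚ + 1ℚ))) - 1ℚ)) p-inv q-inv ⟩
  rhs + b * (1ℚ - 1ℚ) + c * (1ℚ - 1ℚ) + t * (u * (J + M + (1ℚ + 1ℚ)) - 1ℚ) + (s + t * (u * (J + M + (1ℚ + 1ℚ)))) * (v * (J + M + (1ℚ + (1ℚ + 1ℚ))) - 1ℚ)
    ≡⟨ cong₂ (λ x y → rhs + b * (1ℚ - 1ℚ) + c * (1ℚ - 1ℚ) + t * (x - 1ℚ) + (s + t * x) * (y - 1ℚ)) u-inv v-inv ⟩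
  rhs + b * (1ℚ - 1ℚ) + c * (1ℚ - 1ℚ) + t * (1ℚ - 1ℚ) + (s + t * 1ℚ) * (1ℚ - 1ℚ)
    ≡⟨ vanish rhs b c t s ⟩
  rhs ∎
  where
  open ≡-Reasoning
  rhs =
    (- ((J + (1ℚ + 1ℚ)) * (J + (1ℚ + 1ℚ))) * w * (f * ((J + 1ℚ) * (J + 1ℚ)) * u * v) + (J + 1ℚ) * (J + 1ℚ) * (w * (f * (J - M + 1ℚ) * u)))
    - (M + 1ℚ) * (M + 1ℚ) * (1ℚ - (M + (1ℚ + 1ℚ)) * (M + (1ℚ + 1ℚ)) * q + M * M * p) * (w * (f * (J - M + 1ℚ) * u))
    + ½ * (M * M * (M + 1ℚ)) * p * (w * f)
  -- The terms with `s` and `t` supply the factors `u` and `v` missing from parts of `rhs`. All is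
  -- then w f u v times a polynomial, and `b` and `c` remove p and q.
  b = w * f * (u * v) * (½ * (M * M) * (M + 1ℚ) * (J + M + (1ℚ + (1ℚ + 1ℚ))) * (J - M))
  c = w * f * (u * v) * (- ½ * (M + 1ℚ) * ((M + (1ℚ + 1ℚ)) * (M + (1ℚ + 1ℚ))) * (J - M + 1ℚ) * (J + M + (1ℚ + 1ℚ)))
  s = ((J + 1ℚ) * (J + 1ℚ) - (M + 1ℚ) * (M + 1ℚ) * (1ℚ - (M + (1ℚ + 1ℚ)) * (M + (1ℚ + 1ℚ)) * q + M * M * p)) * (w * (f * (J - M + 1ℚ) * u))
  t = ½ * (M * M * (M + 1ℚ)) * p * (w * f)
  vanish : ∀ r b c t s → r + b * (1ℚ - 1ℚ) + c * (1ℚ - 1ℚ) + t * (1ℚ - 1ℚ) + (s + t * 1ℚ) * (1ℚ - 1ℚ) ≡ r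
  vanish = solve-∀ ring
  difference : ∀ J M p q u v w f →
    w * (- ½ * (M + 1ℚ) * ((M + (1ℚ + 1ℚ)) * (M + (1ℚ + 1ℚ))) * q) * ((f * (J - M + 1ℚ) * u) * (J - M) * v) ≡
    (- ((J + (1ℚ + 1ℚ)) * (J + (1ℚ + 1ℚ))) * w * (f * ((J + 1ℚ) * (J + 1ℚ)) * u * v) + (J + 1ℚ) * (J + 1ℚ) * (w * (f * (J - M + 1ℚ) * u)))
    - (M + 1ℚ) * (M + 1ℚ) * (1ℚ - (M + (1ℚ + 1ℚ)) * (M + (1ℚ + 1ℚ)) * q + M * M * p) * (w * (f * (J - M + 1ℚ) * u))
    + ½ * (M * M * (M + 1ℚ)) * p * (w * f)
    + w * f * (u * v) * (½ * (M * M) * (M + 1ℚ) * (J + M + (1ℚ + (1ℚ + 1ℚ))) * (J - M)) * (p * (M + M + 1ℚ) - 1ℚ)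
    + w * f * (u * v) * (- ½ * (M + 1ℚ) * ((M + (1ℚ + 1ℚ)) * (M + (1ℚ + 1ℚ))) * (J - M + 1ℚ) * (J + M + (1ℚ + 1ℚ))) * (q * (M + M + (1ℚ + (1ℚ + 1ℚ))) - 1ℚ)
    + ½ * (M * M * (M + 1ℚ)) * p * (w * f) * (u * (J + M + (1ℚ + 1ℚ)) - 1ℚ)
    + (((J + 1ℚ) * (J + 1ℚ) - (M + 1ℚ) * (M + 1ℚ) * (1ℚ - (M + (1ℚ + 1ℚ)) * (M + (1ℚ + 1ℚ)) * q + M * M * p)) * (w * (f * (J - M + 1ℚ) * u))
       + ½ * (M * M * (M + 1ℚ)) * p * (w * f) * (u * (J + M + (1ℚ + 1ℚ)))) * (v * (J + M + (1ℚ + (1ℚ + 1ℚ))) - 1ℚ)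
  difference = solve-∀ ring

fromℕ-suc² : ∀ n → fromℕ (suc (suc n)) ≡ fromℕ n + (1ℚ + 1ℚ)
fromℕ-suc² n = trans (fromℕ-suc (suc n)) (trans (cong (_+ 1ℚ) (fromℕ-suc n)) (+-assoc (fromℕ n) 1ℚ 1ℚ))

1/odd-inverse : ∀ n → 1/odd n * (fromℕ n + fromℕ n + 1ℚ) ≡ 1ℚ
1/odd-inverse n = begin
  1/odd n * (fromℕ n + fromℕ n + 1ℚ)    ≡⟨ *-comm (1/odd n) _ ⟩
  (fromℕ n + fromℕ n + 1ℚ) * 1/odd n    ≡⟨ cong (λ x → (x + 1ℚ) * 1/odd n) (fromℕ-+ n n) ⟨
  (fromℕ (n ℕ.+ n) + 1ℚ) * 1/odd n      ≡⟨ fromℕ-*-1/1+ (n ℕ.+ n) ⟩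
  1ℚ                                    ∎
  where open ≡-Reasoning

1/odd-suc-inverse : ∀ n → 1/odd (suc n) * (fromℕ n + fromℕ n + (1ℚ + (1ℚ + 1ℚ))) ≡ 1ℚ
1/odd-suc-inverse n = trans
  (cong (1/odd (suc n) *_) (trans (lemma (fromℕ n)) (cong (λ x → x + x + 1ℚ) (sym (fromℕ-suc n)))))
  (1/odd-inverse (suc n))
  where
  lemma : ∀ x → x + x + (1ℚ + (1ℚ + 1ℚ)) ≡ (x + 1ℚ) + (x + 1ℚ) + 1ℚ
  lemma = solve-∀ ring

1/2+-inverse : ∀ n j → 1/1+ suc (n ℕ.+ j) * (fromℕ j + fromℕ n + (1ℚ + 1ℚ)) ≡ 1ℚ
1/2+-inverse n j = begin
  x * (fromℕ j + fromℕ n + (1ℚ + 1ℚ))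
    ≡⟨ lemma x (fromℕ j) (fromℕ n) ⟩
  (fromℕ n + fromℕ j + 1ℚ + 1ℚ) * x
    ≡⟨ cong (λ y → (y + 1ℚ + 1ℚ) * x) (fromℕ-+ n j) ⟨
  (fromℕ (n ℕ.+ j) + 1ℚ + 1ℚ) * x
    ≡⟨ cong (λ y → (y + 1ℚ) * x) (fromℕ-suc (n ℕ.+ j)) ⟨
  (fromℕ (suc (n ℕ.+ j)) + 1ℚ) * x
    ≡⟨ fromℕ-*-1/1+ (suc (n ℕ.+ j)) ⟩
  1ℚ ∎
  where
  open ≡-Reasoning
  x = 1/1+ suc (n ℕ.+ j)
  lemma : ∀ x j n → x * (j + n + (1ℚ + 1ℚ)) ≡ (n + j + 1ℚ + 1ℚ) * x
  lemma = solve-∀ ring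

1/3+-inverse : ∀ n j → 1/1+ suc (suc n ℕ.+ j) * (fromℕ j + fromℕ n + (1ℚ + (1ℚ + 1ℚ))) ≡ 1ℚ
1/3+-inverse n j = trans
  (cong (1/1+ suc (suc n ℕ.+ j) *_) (trans (lemma (fromℕ j) (fromℕ n)) (cong (λ x → fromℕ j + x + (1ℚ + 1ℚ)) (sym (fromℕ-suc n)))))
  (1/2+-inverse (suc n) j)
  where
  lemma : ∀ j n → j + n + (1ℚ + (1ℚ + 1ℚ)) ≡ j + (n + 1ℚ) + (1ℚ + 1ℚ)
  lemma = solve-∀ ring

weight : ℕ → ℕ → ℚ
weight n j = signedSquareFactorial j * ((fromℕ j + 1ℚ) * (fromℕ j + 1ℚ)) * κ n

closedForm : ℕ → ℕ → ℚ
closedForm n j = weight n j * F n j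

-- `bernoulli′-symmetric` gives L(ψⱼ) = V (j + 1)/(j + 2), which is V (j + 1)² times 1/((j + 1)(j +
-- 2)).
closedForm-zero : ∀ j → mulAll (squares j) moments 0 ≡ closedForm 0 j
closedForm-zero j = fromℕ-cancel (suc (suc j)) _ _ (begin
  fromℕ (suc (suc j)) * mulAll (squares j) moments 0
    ≡⟨ cong (fromℕ (suc (suc j)) *_) (mulAll-moments j 0) ⟩
  fromℕ (suc (suc j)) * mulAll (symmetricRoots j) bernoulli′ 2
    ≡⟨ bernoulli′-symmetric j ⟩
  fromℕ (suc j) * V
    ≡⟨ cong (_* V) (fromℕ-suc j) ⟩
  A * V
    ≡⟨ pad A V ⟩
  A * V * 1ℚ * 1ℚ
    ≡⟨ cong₂ (λ x y → A * V * x * y) (fromℕ-*-1/1+ j) (fromℕ-*-1/ (suc (suc j))) ⟨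
  A * V * (A * 1/1+ j) * (fromℕ (suc (suc j)) * 1/1+ suc j)
    ≡⟨ regroup A V (1/1+ j) (fromℕ (suc (suc j))) (1/1+ suc j) ⟩
  fromℕ (suc (suc j)) * closedForm 0 j ∎)
  where
  open ≡-Reasoning
  A = fromℕ j + 1ℚ
  V = signedSquareFactorial j
  pad : ∀ a v → a * v ≡ a * v * 1ℚ * 1ℚ
  pad = solve-∀ ring
  regroup : ∀ a v x b y → a * v * (a * x) * (b * y) ≡ b * (v * (a * a) * 1ℚ * (x * y))
  regroup = solve-∀ ring

-- Here f and r play the parts of `F (n - 1) j` and `P (n - 1)`. Keeping them abstract lets the
-- first step, where n - 1 is no natural number, share the argument.
closedForm-step : ∀ n j f r →
  F n j ≡ f * (fromℕ j - fromℕ n + 1ℚ) * 1/1+ suc (n ℕ.+ j) →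
  F n (suc j) ≡ f * ((fromℕ j + 1ℚ) * (fromℕ j + 1ℚ)) * 1/1+ suc (n ℕ.+ j) * 1/1+ suc (suc n ℕ.+ j) →
  β n * mulAll (squares j) r 0 ≡ - (½ * (fromℕ n * fromℕ n * (fromℕ n + 1ℚ)) * 1/odd n * (weight n j * f)) →
  (∀ i → mulAll (squares i) (P n) 0 ≡ closedForm n i) →
  mulAll (squares j) (combine (α n) (β n) (shift (P n)) (P n) r) 0 ≡ closedForm (suc n) j
closedForm-step n j f r F≡ Fsuc≡ r≡ Pn≡ = begin
  mulAll (squares j) (combine (α n) (β n) (shift (P n)) (P n) r) 0
    ≡⟨ mulAll-combine (squares j) (α n) (β n) (shift (P n)) (P n) r 0 ⟩
  mulAll (squares j) (shift (P n)) 0 - α n * mulAll (squares j) (P n) 0 - β n * mulAll (squares j) r 0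
    ≡⟨ cong₂ _-_ (cong₂ (λ x y → x - α n * y) shifted (Pn≡ j)) r≡ ⟩
  (- (B * B) * W * (f * (A * A) * u * v) + A * A * (W * F n j)) - α n * (W * F n j) - - (½ * (M * M * (M + 1ℚ)) * 1/odd n * (W * f))
    ≡⟨ cong (λ x → (- (B * B) * W * (f * (A * A) * u * v) + A * A * (W * F n j)) - α n * (W * F n j) + x) (neg-involutive (½ * (M * M * (M + 1ℚ)) * 1/odd n * (W * f))) ⟩
  (- (B * B) * W * (f * (A * A) * u * v) + A * A * (W * F n j)) - α n * (W * F n j) + ½ * (M * M * (M + 1ℚ)) * 1/odd n * (W * f)
    ≡⟨ recurrence-identity J M (1/odd n) (1/odd (suc n)) u v W f (F n j)
         (1/odd-inverse n) (1/odd-suc-inverse n) (1/2+-inverse n j) (1/3+-inverse n j) F≡ ⟨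
  W * (- ½ * (M + 1ℚ) * ((M + (1ℚ + 1ℚ)) * (M + (1ℚ + 1ℚ))) * 1/odd (suc n)) * (F n j * (J - M) * v)
    ≡⟨ regroup (signedSquareFactorial j * (A * A)) (κ n) (- ½ * (M + 1ℚ) * ((M + (1ℚ + 1ℚ)) * (M + (1ℚ + 1ℚ))) * 1/odd (suc n)) (F (suc n) j) ⟩
  closedForm (suc n) j ∎
  where
  open ≡-Reasoning
  J = fromℕ j
  M = fromℕ n
  A = J + 1ℚ
  B = J + (1ℚ + 1ℚ)
  W = weight n j
  u = 1/1+ suc (n ℕ.+ j)
  v = 1/1+ suc (suc n ℕ.+ j)
  neg-involutive : ∀ x → - - x ≡ x
  neg-involutive = solve-∀ ring
  regroup : ∀ a k c g → a * k * c * g ≡ a * (c * k) * g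
  regroup = solve-∀ ring
  unfold : ∀ s a x y → s ≡ (s - a * a * x) + a * a * x
  unfold = solve-∀ ring
  factors : ∀ a b V k x → - (a * a) * V * (b * b) * k * x ≡ - (b * b) * (V * (a * a) * k) * x
  factors = solve-∀ ring
  shifted : mulAll (squares j) (shift (P n)) 0 ≡ - (B * B) * W * (f * (A * A) * u * v) + A * A * (W * F n j)
  shifted = begin
    mulAll (squares j) (shift (P n)) 0
      ≡⟨ mulAll-shift (squares j) (P n) 0 ⟩
    mulAll (squares j) (P n) 1
      ≡⟨ unfold (mulAll (squares j) (P n) 1) (fromℕ (suc j)) (mulAll (squares j) (P n) 0) 0ℚ ⟩
    mulAll (squares (suc j)) (P n) 0 + fromℕ (suc j) * fromℕ (suc j) * mulAll (squares j) (P n) 0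
      ≡⟨ cong₂ (λ x y → x + fromℕ (suc j) * fromℕ (suc j) * y) (Pn≡ (suc j)) (Pn≡ j) ⟩
    closedForm n (suc j) + fromℕ (suc j) * fromℕ (suc j) * closedForm n j
      ≡⟨ cong₂ (λ a b → - (a * a) * signedSquareFactorial j * (b * b) * κ n * F n (suc j) + a * a * closedForm n j)
           (fromℕ-suc j) (trans (sym (fromℕ-suc (suc j))) (fromℕ-suc² j)) ⟩
    - (A * A) * signedSquareFactorial j * (B * B) * κ n * F n (suc j) + A * A * closedForm n j
      ≡⟨ cong (λ x → x + A * A * closedForm n j)
           (trans (factors A B (signedSquareFactorial j) (κ n) (F n (suc j))) (cong (- (B * B) * W *_) Fsuc≡)) ⟩
    - (B * B) * W * (f * (A * A) * u * v) + A * A * (W * F n j) ∎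

mulAll-P : ∀ n j → mulAll (squares j) (P n) 0 ≡ closedForm n j
mulAll-P zero j = closedForm-zero j
-- The value 1/(j + 1)² continues `F` to n = -1, and the third hypothesis holds because both sides
-- are 0.
mulAll-P (suc zero) j = closedForm-step 0 j (1/1+ j * 1/1+ j) moments
  F₀ F₀-suc
  (lemma (mulAll (squares j) moments 0) (weight 0 j * (1/1+ j * 1/1+ j)))
  closedForm-zero
  where
  open ≡-Reasoning
  A = fromℕ j + 1ℚ
  x = 1/1+ j
  u = 1/1+ suc j
  v = 1/1+ suc (suc j)
  lemma : ∀ y z → 0ℚ * y ≡ - (½ * (0ℚ * 0ℚ * (0ℚ + 1ℚ)) * 1ℚ * z)
  lemma = solve-∀ ring
  F₀ : x * u ≡ x * x * (fromℕ j - 0ℚ + 1ℚ) * u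
  F₀ = begin
    x * u                                  ≡⟨ cong (_* u) (*-identityʳ x) ⟨
    x * 1ℚ * u                             ≡⟨ cong (λ y → x * y * u) (fromℕ-*-1/1+ j) ⟨
    x * (A * x) * u                        ≡⟨ regroup (fromℕ j) x u ⟩
    x * x * (fromℕ j - 0ℚ + 1ℚ) * u        ∎
    where
    regroup : ∀ j x u → x * ((j + 1ℚ) * x) * u ≡ x * x * (j - 0ℚ + 1ℚ) * u
    regroup = solve-∀ ring
  F₀-suc : u * v ≡ x * x * (A * A) * u * v
  F₀-suc = begin
    u * v                            ≡⟨ pad u v ⟩
    1ℚ * 1ℚ * u * v                  ≡⟨ cong (λ y → y * y * u * v) (fromℕ-*-1/1+ j) ⟨
    (A * x) * (A * x) * u * v        ≡⟨ regroup A x u v ⟩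
    x * x * (A * A) * u * v          ∎
    where
    pad : ∀ u v → u * v ≡ 1ℚ * 1ℚ * u * v
    pad = solve-∀ ring
    regroup : ∀ a x u v → (a * x) * (a * x) * u * v ≡ x * x * (a * a) * u * v
    regroup = solve-∀ ring
mulAll-P (suc (suc n)) j = closedForm-step (suc n) j (F n j) (P n)
  (cong (λ x → F n j * x * 1/1+ suc (suc n ℕ.+ j))
    (trans (difference (fromℕ j) (fromℕ n)) (cong (λ m → fromℕ j - m + 1ℚ) (sym (fromℕ-suc n)))))
  (F-shift n j)
  previous
  (mulAll-P (suc n))
  where
  difference : ∀ j n → j - n ≡ j - (n + 1ℚ) + 1ℚ
  difference = solve-∀ ring
  open ≡-Reasoning
  d = 1/odd (suc n)
  W₀ = signedSquareFactorial j * ((fromℕ j + 1ℚ) * (fromℕ j + 1ℚ))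
  regroup : ∀ n d w k f →
    (n + 1ℚ) * (n + 1ℚ) * (n + 1ℚ) * ((n + 1ℚ + 1ℚ) * (n + 1ℚ + 1ℚ) * (n + 1ℚ + 1ℚ)) * (½ * ½) * (d * d) * (w * k * f) ≡
    - (½ * ((n + 1ℚ) * (n + 1ℚ) * (n + 1ℚ + 1ℚ)) * d * (w * (- ½ * (n + 1ℚ) * ((n + (1ℚ + 1ℚ)) * (n + (1ℚ + 1ℚ))) * d * k) * f))
  regroup = solve-∀ ring
  -- `β (suc n)` is the product of - κₙ₊₁/κₙ and ½ (n + 1)² (n + 2)/(2n + 3), so the weight passes
  -- from n to n + 1.
  previous : β (suc n) * mulAll (squares j) (P n) 0 ≡
    - (½ * (fromℕ (suc n) * fromℕ (suc n) * (fromℕ (suc n) + 1ℚ)) * d * (weight (suc n) j * F n j))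
  previous = begin
    β (suc n) * mulAll (squares j) (P n) 0
      ≡⟨ cong (β (suc n) *_) (mulAll-P n j) ⟩
    β (suc n) * closedForm n j
      ≡⟨ cong (λ m → m * m * m * ((m + 1ℚ) * (m + 1ℚ) * (m + 1ℚ)) * (½ * ½) * (d * d) * closedForm n j) (fromℕ-suc n) ⟩
    _ ≡⟨ regroup (fromℕ n) d W₀ (κ n) (F n j) ⟩
    _ ≡⟨ cong (λ m → - (½ * (m * m * (m + 1ℚ)) * d * (weight (suc n) j * F n j))) (fromℕ-suc n) ⟨
    - (½ * (fromℕ (suc n) * fromℕ (suc n) * (fromℕ (suc n) + 1ℚ)) * d * (weight (suc n) j * F n j)) ∎

-- Orthogonality, norms and the product formula.

P-orthogonal : ∀ n j → j ℕ.< n → mulAll (squares j) (P n) 0 ≡ 0ℚ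
P-orthogonal n j j<n = trans (mulAll-P n j) (trans (cong (weight n j *_) (F-zero n j j<n)) (*-zeroʳ (weight n j)))

P-zero : ∀ n {k} → k ℕ.< n → P n k ≡ 0ℚ
P-zero n {k} k<n = mulAll-squares-zero (P n) (P-orthogonal n) k 0 (subst (ℕ._< n) (sym (ℕ.+-identityʳ k)) k<n)

norm : ℕ → ℚ
norm n = P n n

norm-closedForm : ∀ n → norm n ≡ closedForm n n
norm-closedForm n = trans (mulAll-squares-last (P n) (P-orthogonal n) n 0 (ℕ.+-identityʳ n)) (mulAll-P n n)

-- The usual ratio of consecutive norms of monic orthogonal polynomials, read off from the diagonal
-- of the closed form.
norm-suc : ∀ n → norm (suc n) ≡ β (suc n) * norm n
norm-suc n = begin
  norm (suc n)
    ≡⟨ norm-closedForm (suc n) ⟩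
  closedForm (suc n) (suc n)
    ≡⟨ cong (λ x → weight (suc n) (suc n) * x) (F-shift n n) ⟩
  - (fromℕ (suc n) * fromℕ (suc n)) * V * ((fromℕ (suc n) + 1ℚ) * (fromℕ (suc n) + 1ℚ)) * κ (suc n) * (F n n * (A * A) * 1/1+ suc (suc (n ℕ.+ n)) * z)
    ≡⟨ cong₂ (λ m y → - (m * m) * V * ((m + 1ℚ) * (m + 1ℚ)) * κ (suc n) * (F n n * (A * A) * y * z))
         (fromℕ-suc n) (cong (λ k → 1/1+ suc k) (sym (ℕ.+-suc n n))) ⟩
  - (A * A) * V * ((A + 1ℚ) * (A + 1ℚ)) * κ (suc n) * (F n n * (A * A) * d * z)
    -- One 1/(2n + 3) comes from `κ` and one from `F-shift`; `z` is 1/(2n + 4) and cancels against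
    -- the factor split off.
    ≡⟨ expand N d V (κ n) (F n n) z ⟩
  (z * (A + N + (1ℚ + (1ℚ + 1ℚ)))) * (β′ * closedForm n n)
    ≡⟨ cong₂ _*_ z-inverse (cong₂ _*_ (cong (λ m → m * m * m * ((m + 1ℚ) * (m + 1ℚ) * (m + 1ℚ)) * (½ * ½) * (d * d)) (sym (fromℕ-suc n))) (sym (norm-closedForm n))) ⟩
  1ℚ * (β (suc n) * norm n)
    ≡⟨ *-identityˡ (β (suc n) * norm n) ⟩
  β (suc n) * norm n ∎
  where
  open ≡-Reasoning
  N = fromℕ n
  A = N + 1ℚ
  V = signedSquareFactorial n
  d = 1/odd (suc n)
  z = 1/1+ suc (suc (suc (n ℕ.+ n)))
  β′ = A * A * A * ((A + 1ℚ) * (A + 1ℚ) * (A + 1ℚ)) * (½ * ½) * (d * d)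
  expand : ∀ n d V k f z →
    - ((n + 1ℚ) * (n + 1ℚ)) * V * ((n + 1ℚ + 1ℚ) * (n + 1ℚ + 1ℚ)) * (- ½ * (n + 1ℚ) * ((n + (1ℚ + 1ℚ)) * (n + (1ℚ + 1ℚ))) * d * k) * (f * ((n + 1ℚ) * (n + 1ℚ)) * d * z) ≡
    (z * (n + 1ℚ + n + (1ℚ + (1ℚ + 1ℚ)))) *
    ((n + 1ℚ) * (n + 1ℚ) * (n + 1ℚ) * ((n + 1ℚ + 1ℚ) * (n + 1ℚ + 1ℚ) * (n + 1ℚ + 1ℚ)) * (½ * ½) * (d * d) * (V * ((n + 1ℚ) * (n + 1ℚ)) * k * f))
  expand = solve-∀ ring
  z-inverse : z * (A + N + (1ℚ + (1ℚ + 1ℚ))) ≡ 1ℚ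
  z-inverse = trans
    (cong₂ (λ k m → 1/1+ suc (suc k) * (m + N + (1ℚ + (1ℚ + 1ℚ)))) (sym (ℕ.+-suc n n)) (sym (fromℕ-suc n)))
    (1/3+-inverse n (suc n))

/-unique : ∀ a b .{{_ : ℕ.NonZero b}} x → fromℕ b * x ≡ fromℕ a → x ≡ + a / b
/-unique a b@(suc b′) x bx≡a = fromℕ-cancel b x (+ a / b) (trans bx≡a (sym (toℚᵘ-injective (begin-equality
  toℚᵘ (fromℕ b * (+ a / b))          ≃⟨ toℚᵘ-homo-* (fromℕ b) (+ a / b) ⟩
  toℚᵘ (fromℕ b) ℚᵘ.* toℚᵘ (+ a / b)  ≃⟨ ℚᵘ.*-cong (toℚᵘ-fromℚᵘ (ℚᵘ.mkℚᵘ (+ b) 0)) (toℚᵘ-fromℚᵘ (ℚᵘ.mkℚᵘ (+ a) b′)) ⟩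
  ℚᵘ.mkℚᵘ (+ b) 0 ℚᵘ.* ℚᵘ.mkℚᵘ (+ a) b′
    ≃⟨ ℚᵘ.*≡* (trans (ℤ.*-identityʳ (+ b ℤ.* + a)) (trans (ℤ.*-comm (+ b) (+ a)) (cong (λ k → + a ℤ.* + k) (sym (ℕ.*-identityˡ b))))) ⟩
  ℚᵘ.mkℚᵘ (+ a) 0                     ≃⟨ toℚᵘ-fromℚᵘ (ℚᵘ.mkℚᵘ (+ a) 0) ⟨
  toℚᵘ (fromℕ a)                      ∎))))
  where open ℚᵘ.≤-Reasoning

ratio : ℕ → ℚ
ratio ℓ = + (ℓ ℕ.^ 3 ℕ.* (ℓ ℕ.+ 1) ℕ.^ 3) / (4 ℕ.* (1 ℕ.+ 2 ℕ.* ℓ) ℕ.^ 2)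

fromℕ-^ : ∀ m n → fromℕ (m ℕ.^ n) ≡ fromℕ m ^ n
fromℕ-^ m zero    = refl
fromℕ-^ m (suc n) = trans (fromℕ-* m (m ℕ.^ n)) (cong (fromℕ m *_) (fromℕ-^ m n))

β≡ratio : ∀ ℓ → β ℓ ≡ ratio ℓ
β≡ratio ℓ = /-unique (ℓ ℕ.^ 3 ℕ.* (ℓ ℕ.+ 1) ℕ.^ 3) (4 ℕ.* (1 ℕ.+ 2 ℕ.* ℓ) ℕ.^ 2) (β ℓ) (begin
  fromℕ (4 ℕ.* (1 ℕ.+ 2 ℕ.* ℓ) ℕ.^ 2) * β ℓ
    ≡⟨ cong (_* β ℓ) (trans (fromℕ-* 4 ((1 ℕ.+ 2 ℕ.* ℓ) ℕ.^ 2)) (cong (fromℕ 4 *_) (fromℕ-^ (1 ℕ.+ 2 ℕ.* ℓ) 2))) ⟩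
  fromℕ 4 * (o * (o * 1ℚ)) * β ℓ
    ≡⟨ cong (λ x → fromℕ 4 * (x * (x * 1ℚ)) * β ℓ) (trans (cong fromℕ (ℕ.+-comm 1 (2 ℕ.* ℓ))) (trans (fromℕ-+ (2 ℕ.* ℓ) 1) (cong (_+ 1ℚ) (trans (cong (λ k → fromℕ (ℓ ℕ.+ k)) (ℕ.+-identityʳ ℓ)) (fromℕ-+ ℓ ℓ))))) ⟩
  fromℕ 4 * ((x + x + 1ℚ) * ((x + x + 1ℚ) * 1ℚ)) * β ℓ
    ≡⟨ regroup x d ⟩
  (d * (x + x + 1ℚ)) * (d * (x + x + 1ℚ)) * (x * (x * (x * 1ℚ)) * ((x + 1ℚ) * ((x + 1ℚ) * ((x + 1ℚ) * 1ℚ))))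
    ≡⟨ cong (λ y → y * y * (x * (x * (x * 1ℚ)) * ((x + 1ℚ) * ((x + 1ℚ) * ((x + 1ℚ) * 1ℚ))))) (1/odd-inverse ℓ) ⟩
  1ℚ * (x ^ 3 * (x + 1ℚ) ^ 3)
    ≡⟨ *-identityˡ _ ⟩
  x ^ 3 * (x + 1ℚ) ^ 3
    ≡⟨ cong₂ _*_ (fromℕ-^ ℓ 3) (trans (fromℕ-^ (ℓ ℕ.+ 1) 3) (cong (_^ 3) (fromℕ-+ ℓ 1))) ⟨
  fromℕ (ℓ ℕ.^ 3) * fromℕ ((ℓ ℕ.+ 1) ℕ.^ 3)
    ≡⟨ fromℕ-* (ℓ ℕ.^ 3) ((ℓ ℕ.+ 1) ℕ.^ 3) ⟨
  fromℕ (ℓ ℕ.^ 3 ℕ.* (ℓ ℕ.+ 1) ℕ.^ 3) ∎)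
  where
  open ≡-Reasoning
  x = fromℕ ℓ
  d = 1/odd ℓ
  o = fromℕ (1 ℕ.+ 2 ℕ.* ℓ)
  regroup : ∀ x d → (1ℚ + 1ℚ + 1ℚ + 1ℚ) * ((x + x + 1ℚ) * ((x + x + 1ℚ) * 1ℚ)) * (x * x * x * ((x + 1ℚ) * (x + 1ℚ) * (x + 1ℚ)) * (½ * ½) * (d * d)) ≡
    (d * (x + x + 1ℚ)) * (d * (x + x + 1ℚ)) * (x * (x * (x * 1ℚ)) * ((x + 1ℚ) * ((x + 1ℚ) * ((x + 1ℚ) * 1ℚ))))
  regroup = solve-∀ ring

∏-suc : ∀ n f → ∏[1⋯ suc n ] f ≡ ∏[1⋯ n ] f * f (suc n)
∏-suc zero    f = trans (*-identityʳ (f 1)) (sym (*-identityˡ (f 1)))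
∏-suc (suc n) f = trans (cong (f 1 *_) (∏-suc n (λ k → f (suc k)))) (sym (*-assoc (f 1) _ _))

norm-product : ∀ n → norm n ≡ ½ * ∏[1⋯ n ] ratio
-- Both sides compute to 1/2: L(1) = 3 B₂.
norm-product zero    = refl
norm-product (suc n) = begin
  norm (suc n)                                ≡⟨ norm-suc n ⟩
  β (suc n) * norm n                          ≡⟨ cong₂ _*_ (β≡ratio (suc n)) (norm-product n) ⟩
  ratio (suc n) * (½ * ∏[1⋯ n ] ratio)        ≡⟨ regroup (ratio (suc n)) (∏[1⋯ n ] ratio) ⟩
  ½ * (∏[1⋯ n ] ratio * ratio (suc n))        ≡⟨ cong (½ *_) (∏-suc n ratio) ⟨
  ½ * ∏[1⋯ suc n ] ratio                      ∎
  where
  open ≡-Reasoning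
  regroup : ∀ r p → r * (½ * p) ≡ ½ * (p * r)
  regroup = solve-∀ ring

-- Passing from n to n + 1 raises every exponent by one, and the new factor enters with exponent 1.
∏-exponents : ∀ n f →
  ∏[1⋯ suc n ] (λ ℓ → f ℓ ^ (suc n ℕ.+ 1 ∸ ℓ)) ≡ ∏[1⋯ suc n ] f * ∏[1⋯ n ] (λ ℓ → f ℓ ^ (n ℕ.+ 1 ∸ ℓ))
∏-exponents n f = begin
  ∏[1⋯ suc n ] (λ ℓ → f ℓ ^ (suc n ℕ.+ 1 ∸ ℓ))
    ≡⟨ ∏-suc n (λ ℓ → f ℓ ^ (suc n ℕ.+ 1 ∸ ℓ)) ⟩
  ∏[1⋯ n ] (λ ℓ → f ℓ ^ (suc n ℕ.+ 1 ∸ ℓ)) * f (suc n) ^ (n ℕ.+ 1 ∸ n)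
    ≡⟨ cong₂ _*_
         (trans (Product.sum-cong-≗ {n} split) (Product.∑-distrib-+ {n} (λ i → f (suc (toℕ i))) (λ i → f (suc (toℕ i)) ^ (n ℕ.+ 1 ∸ suc (toℕ i)))))
         (trans (cong (f (suc n) ^_) (ℕ.m+n∸m≡n n 1)) (*-identityʳ (f (suc n)))) ⟩
  ∏[1⋯ n ] f * p * f (suc n)
    ≡⟨ regroup (∏[1⋯ n ] f) p (f (suc n)) ⟩
  ∏[1⋯ n ] f * f (suc n) * p
    ≡⟨ cong (_* p) (∏-suc n f) ⟨
  ∏[1⋯ suc n ] f * p ∎
  where
  open ≡-Reasoning
  p = ∏[1⋯ n ] (λ ℓ → f ℓ ^ (n ℕ.+ 1 ∸ ℓ))
  regroup : ∀ x y z → x * y * z ≡ x * z * y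
  regroup = solve-∀ ring
  split : ∀ (i : Fin n) → f (suc (toℕ i)) ^ (suc n ℕ.+ 1 ∸ suc (toℕ i)) ≡
    f (suc (toℕ i)) * f (suc (toℕ i)) ^ (n ℕ.+ 1 ∸ suc (toℕ i))
  split i = cong (f (suc (toℕ i)) ^_) (begin
    n ℕ.+ 1 ∸ toℕ i              ≡⟨ cong (_∸ toℕ i) (ℕ.+-comm n 1) ⟩
    suc n ∸ toℕ i                ≡⟨ ℕ.+-∸-assoc 1 (ℕ.<⇒≤ (Fin.toℕ<n i)) ⟩
    suc (n ∸ toℕ i)              ≡⟨ cong (λ k → suc (k ∸ suc (toℕ i))) (ℕ.+-comm n 1) ⟨
    suc (n ℕ.+ 1 ∸ suc (toℕ i))  ∎)

hankelDet-moments : ∀ n → hankelDet n moments ≡ ½ ^ (n ℕ.+ 1) * ∏[1⋯ n ] (λ ℓ → ratio ℓ ^ (n ℕ.+ 1 ∸ ℓ))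
hankelDet-moments zero    = refl
hankelDet-moments (suc n) = begin
  hankelDet (suc n) moments
    -- `hankelDet n moments` unfolds to `Det (columns (suc n))`.
    ≡⟨ Det-step (suc n) (P-zero (suc n)) ⟩
  norm (suc n) * hankelDet n moments
    ≡⟨ cong₂ _*_ (norm-product (suc n)) (hankelDet-moments n) ⟩
  ½ * ∏[1⋯ suc n ] ratio * (½ ^ (n ℕ.+ 1) * p)
    ≡⟨ regroup (∏[1⋯ suc n ] ratio) (½ ^ (n ℕ.+ 1)) p ⟩
  ½ ^ (suc n ℕ.+ 1) * (∏[1⋯ suc n ] ratio * p)
    ≡⟨ cong (½ ^ (suc n ℕ.+ 1) *_) (∏-exponents n ratio) ⟨
  ½ ^ (suc n ℕ.+ 1) * ∏[1⋯ suc n ] (λ ℓ → ratio ℓ ^ (suc n ℕ.+ 1 ∸ ℓ)) ∎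
  where
  open ≡-Reasoning
  p = ∏[1⋯ n ] (λ ℓ → ratio ℓ ^ (n ℕ.+ 1 ∸ ℓ))
  regroup : ∀ x h p → ½ * x * (h * p) ≡ ½ * h * (x * p)
  regroup = solve-∀ ring

corollary6p3 : ∀ (n : ℕ) →
    hankelDet n (λ k → fromℕ (2 ℕ.* k ℕ.+ 3) * bernoulli (2 ℕ.* k ℕ.+ 2))
    ≡ ½ ^ (n ℕ.+ 1) * ∏[1⋯ n ] (λ ℓ → (+ (ℓ ℕ.^ 3 ℕ.* (ℓ ℕ.+ 1) ℕ.^ 3) / (4 ℕ.* (1 ℕ.+ 2 ℕ.* ℓ) ℕ.^ 2)) ^ (n ℕ.+ 1 ∸ ℓ))
corollary6p3 n = trans
  -- With the sums commuted, the entries are `moments` by definition.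
  (det-cong {suc n} λ i j → let k = toℕ i ℕ.+ toℕ j in
    cong₂ (λ a b → fromℕ a * bernoulli b) (ℕ.+-comm (2 ℕ.* k) 3) (ℕ.+-comm (2 ℕ.* k) 2))
  (hankelDet-moments n)
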